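{- Let $\Gamma$ be a non-complete distance-regular graph, fix a spanning tree $T$ of $\Gamma$, and let $G$ be the fundamental group of $\Gamma$ with respect to $T$. Let $m>1$ and $n>1$ be integers and let $\rho:G\to S_{mn}$ be a transitive permutation representation such that the permutation group $G\rho$ on $\{1,\ldots,mn\}$ is imprimitive with $m$ blocks of imprimitivity, each of size $n$. Suppose that the cover $\Gamma_\rho$ of $\Gamma$ is a distance-regular antipodal $mn$-cover of $\Gamma$. Then $\Gamma_\rho$ is an $n$-cover of an antipodal distance-regular $m$-cover of $\Gamma$; that is, there exist a graph $\Gamma'$, a covering map $\theta':V(\Gamma')\to V(\Gamma)$ making $(\Gamma',\theta')$ an antipodal $m$-cover of $\Gamma$ with $\Gamma'$ distance-regular, and a covering map $\theta'':V(\Gamma_\rho)\to V(\Gamma')$ making $(\Gamma_\rho,\theta'')$ an $n$-cover of $\Gamma'$, such that $\theta'\circ\theta''$ is the natural covering map $(v,i)\mapsto v$ of $\Gamma_\rho$ onto $\Gamma$.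
   Context: All graphs are finite, undirected, without loops or multiple edges. Each graph is regarded as an abstract 2-dimensional simplicial complex whose 0-, 1-, 2-simplices are its vertices, edges and triangles. For a graph $\Gamma$, a cover of $\Gamma$ is a pair $(\tilde\Gamma,\theta)$ with $\tilde\Gamma$ a graph and $\theta:V(\tilde\Gamma)\to V(\Gamma)$ a surjection (covering map) such that: each fibre $\theta^{ -1}(v)$ is a coclique; the union of two distinct fibres over a non-adjacent pair of vertices of $\Gamma$ is a coclique; the subgraph induced on two fibres over an edge of $\Gamma$ is a perfect matching; and the subgraph induced on three fibres over a triangle of $\Gamma$ is a disjoint union of triangles. It is an $r$-cover if every fibre has size $r$ (double cover for $r=2$, triple cover for $r=3$). For non-complete $\Gamma$, an antipodal $r$-cover is a connected $r$-cover $\tilde\Gamma$ in which the relation "equal or at maximum distance (the diameter of $\tilde\Gamma$)" is an equivalence relation on $V(\tilde\Gamma)$ whose classes are exactly the fibres. Fundamental group: for a connected graph $\Gamma$ with spanning tree $T$, $G$ is the finitely presented group with a generator $g_{v,w}$ for each ordered pair $(v,w)$ of adjacent vertices, and relations $g_{s,t}=1$ for each arc $(s,t)$ of $T$, $g_{v,w}g_{w,v}=1$ for each edge $\{v,w\}$, and $g_{x,y}g_{y,z}g_{z,x}=1$ for each triangle $\{x,y,z\}$ of $\Gamma$. For a transitive permutation representation $\rho:G\to S_r$ (permutations act on the right of $\{1,\dots,r\}$), the graph $\Gamma_\rho$ has vertex set $V(\Gamma)\times\{1,\ldots,r\}$, with $(v,i)$ adjacent to $(w,j)$ iff $\{v,w\}$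 is an edge of $\Gamma$ and $j$ is the image of $i$ under $(g_{v,w})\rho$; together with the map $(v,i)\mapsto v$ it is a connected $r$-cover of $\Gamma$. -}

module Defs where

open import Data.Nat using (ℕ; zero; suc; _+_; _*_)
open import Data.Bool using (Bool; true; false; _∧_; _∨_; not; T; if_then_else_)
open import Data.Fin using (Fin; zero; suc; inject₁; fromℕ)
import Data.Fin as F
open import Data.Fin.Properties using (*↔×)
open import Data.Fin.Permutation using (Permutation′; _⟨$⟩ʳ_; _⟨$⟩ˡ_)
open import Data.Product using (Σ; ∃; _×_; _,_; proj₁; proj₂)
open import Data.Product.Function.NonDependent.Propositional using (_×-↔_)
open import Data.List using (List; []; _∷_)
open import Data.List.Relation.Unary.All using (All)
open import Function.Bundles using (_↔_; Inverse)
open import Function.Properties.Inverse using (↔-trans; ↔-refl)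
open import Relation.Nullary using (¬_)
open import Relation.Nullary.Decidable using (⌊_⌋)
open import Relation.Binary.PropositionalEquality using (_≡_)

-- Finite graphs: a vertex type V with an explicit enumeration
-- Fin size ↔ V and a Bool-valued adjacency relation.
-- (Simplicity is the separate predicate IsGraph.)

record FinGraph : Set₁ where
  field
    V    : Set
    size : ℕ
    enum : Fin size ↔ V
    adj  : V → V → Bool

module _ (G : FinGraph) where
  open FinGraph G

  eqV : V → V → Bool
  eqV x y = ⌊ Inverse.from enum x F.≟ Inverse.from enum y ⌋

  countFin : ∀ {k} → (Fin k → Bool) → ℕ
  countFin {zero}  P = 0
  countFin {suc k} P = (if P zero then 1 else 0) + countFin (λ i → P (suc i))

  anyFin : ∀ {k} → (Fin k → Bool) → Bool
  anyFin {zero}  P = false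
  anyFin {suc k} P = P zero ∨ anyFin (λ i → P (suc i))

  count : (V → Bool) → ℕ
  count P = countFin (λ i → P (Inverse.to enum i))

  anyV : (V → Bool) → Bool
  anyV P = anyFin (λ i → P (Inverse.to enum i))

  IsGraph : Set
  IsGraph = (∀ x y → adj x y ≡ adj y x) × (∀ x → adj x x ≡ false)

  reach : ℕ → V → V → Bool
  reach zero    x y = eqV x y
  reach (suc k) x y = reach k x y ∨ anyV (λ z → reach k x z ∧ adj z y)

  distIs : V → V → ℕ → Bool
  distIs x y zero    = reach zero x y
  distIs x y (suc i) = reach (suc i) x y ∧ not (reach i x y)

  Connected : Set
  Connected = ∀ x y → ∃ λ k → T (reach k x y)

  IsDiameter : ℕ → Set
  IsDiameter D = (∃ λ x → ∃ λ y → T (distIs x y D)) × (∀ x y → T (reach D x y))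

  NonComplete : Set
  NonComplete = ∃ λ x → ∃ λ y → T (not (eqV x y)) × adj x y ≡ false

  DistanceRegular : Set
  DistanceRegular =
    Connected ×
    (Σ (ℕ → ℕ) λ b → Σ (ℕ → ℕ) λ c →
       (∀ i u v → T (distIs u v i) →
          count (λ z → distIs u z (suc i) ∧ adj v z) ≡ b i) ×
       (∀ i u v → T (distIs u v (suc i)) →
          count (λ z → distIs u z i ∧ adj v z) ≡ c (suc i)))

  Coclique : (V → Bool) → Set
  Coclique S = ∀ x y → T (S x) → T (S y) → adj x y ≡ false

  PerfectMatching : (V → Bool) → Set
  PerfectMatching S = ∀ x → T (S x) → count (λ y → S y ∧ adj x y) ≡ 1

  DisjointUnionOfTriangles : (V → Bool) → Set
  DisjointUnionOfTriangles S =
    (∀ x → T (S x) → count (λ y → S y ∧ adj x y) ≡ 2) ×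
    (∀ x y z → T (S x) → T (S y) → T (S z) →
       T (adj x y) → T (adj x z) → T (not (eqV y z)) → T (adj y z))

  Cycle : ℕ → Set
  Cycle k = Σ (Fin (suc (suc (suc k))) → V) λ f →
    (∀ i j → f i ≡ f j → i ≡ j) ×
    (∀ (i : Fin (suc (suc k))) → T (adj (f (inject₁ i)) (f (suc i)))) ×
    T (adj (f (fromℕ (suc (suc k)))) (f zero))

  Acyclic : Set
  Acyclic = ∀ k → ¬ Cycle k

open FinGraph public

spanningSub : (G : FinGraph) → (V G → V G → Bool) → FinGraph
spanningSub G t = record { V = V G ; size = size G ; enum = enum G ; adj = t }

IsSpanningTree : (G : FinGraph) → (V G → V G → Bool) → Set
IsSpanningTree G t =
  (∀ x y → T (t x y) → T (adj G x y)) ×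
  IsGraph (spanningSub G t) × Connected (spanningSub G t) × Acyclic (spanningSub G t)

module _ (Γ H : FinGraph) where
  fibre : (V H → V Γ) → V Γ → V H → Bool
  fibre θ v x = eqV Γ (θ x) v

  record IsCover (θ : V H → V Γ) : Set where
    field
      isGraph    : IsGraph H
      surjective : ∀ v → ∃ λ x → θ x ≡ v
      fibreCoclique : ∀ v → Coclique H (fibre θ v)
      nonEdgeCoclique : ∀ v w → T (not (eqV Γ v w)) → adj Γ v w ≡ false →
        Coclique H (λ x → fibre θ v x ∨ fibre θ w x)
      edgeMatching : ∀ v w → T (adj Γ v w) →
        PerfectMatching H (λ x → fibre θ v x ∨ fibre θ w x)
      triangleTriangles : ∀ u v w → T (adj Γ u v) → T (adj Γ v w) → T (adj Γ u w) →
        DisjointUnionOfTriangles H (λ x → fibre θ u x ∨ fibre θ v x ∨ fibre θ w x)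

  IsRCover : ℕ → (V H → V Γ) → Set
  IsRCover r θ = IsCover θ × (∀ v → count H (fibre θ v) ≡ r)

  -- antipodal r-cover: connected r-cover in which "equal or at distance
  -- the diameter" is an equivalence relation whose classes are the fibres
  IsAntipodalCover : ℕ → (V H → V Γ) → Set
  IsAntipodalCover r θ =
    IsRCover r θ × Connected H ×
    Σ ℕ λ D → IsDiameter H D ×
      (∀ x y → (T (eqV H x y ∨ distIs H x y D) → θ x ≡ θ y) ×
               (θ x ≡ θ y → T (eqV H x y ∨ distIs H x y D)))

-- Permutation representations of the fundamental group G(Γ,T).
-- A homomorphism ρ : G → S_r is given by the images σ v w = (g_{v,w})ρ of
-- the generators (only used for adjacent v,w), subject to the defining
-- relations of G.  Permutations act on the right: i ↦ σ ⟨$⟩ʳ i.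

module _ (Γ : FinGraph) (t : V Γ → V Γ → Bool) {r : ℕ}
         (σ : V Γ → V Γ → Permutation′ r) where

  IsFundRep : Set
  IsFundRep =
    (∀ s u → T (t s u) → ∀ i → σ s u ⟨$⟩ʳ i ≡ i) ×
    (∀ v w → T (adj Γ v w) → ∀ i → σ w v ⟨$⟩ʳ (σ v w ⟨$⟩ʳ i) ≡ i) ×
    (∀ x y z → T (adj Γ x y) → T (adj Γ y z) → T (adj Γ x z) →
       ∀ i → σ z x ⟨$⟩ʳ (σ y z ⟨$⟩ʳ (σ x y ⟨$⟩ʳ i)) ≡ i)

module _ (Γ : FinGraph) {r : ℕ} (σ : V Γ → V Γ → Permutation′ r) where

  -- words in the generators g_{v,w}^{±1}: (v , w , false) is g_{v,w},
  -- (v , w , true) is g_{v,w}⁻¹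
  Letter : Set
  Letter = V Γ × V Γ × Bool

  ValidWord : List Letter → Set
  ValidWord = All (λ { (v , w , _) → T (adj Γ v w) })

  act : List Letter → Fin r → Fin r
  act []                    i = i
  act ((v , w , false) ∷ ws) i = act ws (σ v w ⟨$⟩ʳ i)
  act ((v , w , true)  ∷ ws) i = act ws (σ v w ⟨$⟩ˡ i)

  Transitive : Set
  Transitive = ∀ i j → ∃ λ ws → ValidWord ws × act ws i ≡ j

module _ (Γ : FinGraph) (m n : ℕ) (σ : V Γ → V Γ → Permutation′ (m * n)) where
  ImprimitiveBlocks : Set
  ImprimitiveBlocks =
    Σ (Fin (m * n) → Fin m) λ β →
      (∀ b → countFin Γ (λ i → ⌊ β i F.≟ b ⌋) ≡ n) ×
      (∀ ws → ValidWord Γ σ ws → ∀ i j → β i ≡ β j →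
         β (act Γ σ ws i) ≡ β (act Γ σ ws j))

coverGraph : (Γ : FinGraph) {r : ℕ} → (V Γ → V Γ → Permutation′ r) → FinGraph
coverGraph Γ {r} σ = record
  { V    = V Γ × Fin r
  ; size = size Γ * r
  ; enum = ↔-trans *↔× (enum Γ ×-↔ ↔-refl)
  ; adj  = λ { (v , i) (w , j) → adj Γ v w ∧ ⌊ j F.≟ σ v w ⟨$⟩ʳ i ⌋ }
  }

{-# OPTIONS --safe #-}
module Submission where

-- The m-cover Γ′ has vertices (v , block).  Fix x over a, let D be the diameter
-- of Γ_ρ, and let b be a vertex of Γ′ at distance i from a.  By antipodality the
-- fibre of b contains one vertex at distance i from x, and all its other vertices
-- are at distance max(i, D − i).  Counting the edges between this fibre and the
-- sphere of radius k about x in two ways gives, for each k, an equation whose right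
-- hand side depends on i only and whose unknowns are the numbers X_j of neighbours
-- of b at distance j from a.  The equation of index k involves X_k alone if 2k ≤ D,
-- and X_k and X_{D−k} if 2k > D, so the X_j are determined by i.

open import Defs
open import Data.Bool using (Bool; true; false; _∧_; _∨_; not; T; if_then_else_)
open import Data.Bool.Properties using (T-∧; T-∨; T?)
open import Data.Empty using (⊥-elim)
open import Data.Fin using (Fin; zero; suc)
import Data.Fin as F
import Data.Fin.Properties as F
open import Data.Fin.Permutation using (Permutation′; _⟨$⟩ʳ_)
open import Data.List using ([]; _∷_)
open import Data.List.Relation.Unary.All using ([]; _∷_)
open import Data.Nat
open import Data.Nat.Properties
open import Data.Product using (Σ; ∃; ∃₂; _×_; _,_; proj₁; proj₂)
open import Data.Product.Function.NonDependent.Propositional using (_×-↔_)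
open import Data.Sum using (_⊎_; inj₁; inj₂; [_,_]′)
open import Function.Base using (_∘_)
open import Function.Bundles using (Inverse; Equivalence)
open import Function.Properties.Inverse using (↔-trans; ↔-refl)
open import Relation.Binary.Definitions using (tri<; tri≈; tri>)
open import Relation.Binary.PropositionalEquality
open import Relation.Nullary using (¬_; Dec; yes; no; contradiction)
open import Relation.Nullary.Decidable using (⌊_⌋; toWitness; fromWitness; map′)
open import Algebra.Properties.Semiring.Sum +-*-semiring
  using (sum; sum-cong-≗; ∑-distrib-+; ∑-comm; *-distribˡ-sum)

-- The obstacle: a neighbour of the vertex of the fibre of b nearest to x may fail to be nearest to
-- x in its own fibre, so the intersection numbers of Γ_ρ do not project to Γ′ one vertex at a time.
-- Summing over the whole fibre of b removes this asymmetry, at the price of the coefficient p = n -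
-- 1 for the other vertices of each fibre. The pattern of distances in a fibre has two sources.
-- Regularity lets every geodesic of Γ_ρ be prolonged to length D, so x lies on a geodesic from any
-- given vertex to some antipode of it. The antipodal classes of Γ_ρ are the fibres over Γ, hence
-- unions of fibres over Γ′, so that antipode lies in the class containing the fibre of b. Geodesics
-- of Γ′ lift to Γ_ρ without change of length. Therefore Γ′ has the same D, and its antipodal
-- relation is the image of that of Γ_ρ. Only invariance is needed: the X_j are never computed, and
-- the equations for two pairs at equal distance are compared by cancelling 1 + p.

-- Truth values as numbers, and finite sums

bit : Bool → ℕ
bit b = if b then 1 else 0

bit-true : ∀ {b} → T b → bit b ≡ 1
bit-true {true} _ = refl

bit-false : ∀ {b} → ¬ T b → bit b ≡ 0
bit-false {true}  ¬b = ⊥-elim (¬b _)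
bit-false {false} _  = refl

T-⇔⇒≡ : ∀ {a b} → (T a → T b) → (T b → T a) → a ≡ b
T-⇔⇒≡ {true}  {true}  f g = refl
T-⇔⇒≡ {true}  {false} f g = ⊥-elim (f _)
T-⇔⇒≡ {false} {true}  f g = ⊥-elim (g _)
T-⇔⇒≡ {false} {false} f g = refl

bit-⇔ : ∀ {a b} → (T a → T b) → (T b → T a) → bit a ≡ bit b
bit-⇔ f g = cong bit (T-⇔⇒≡ f g)

bit-∧ : ∀ a b → bit (a ∧ b) ≡ bit a * bit b
bit-∧ true  b = sym (+-identityʳ (bit b))
bit-∧ false b = refl

bit≡0 : ∀ {b} → bit b ≡ 0 → ¬ T b
bit≡0 {true} ()
bit≡0 {false} _ ()

¬T⇒false : ∀ {b} → ¬ T b → b ≡ false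
¬T⇒false {true}  ¬b = ⊥-elim (¬b _)
¬T⇒false {false} _  = refl

false⇒¬T : ∀ {b} → b ≡ false → ¬ T b
false⇒¬T refl ()

T-∧⁻ : ∀ {a b} → T (a ∧ b) → T a × T b
T-∧⁻ = Equivalence.to T-∧

T-∧⁺ : ∀ {a b} → T a → T b → T (a ∧ b)
T-∧⁺ a b = Equivalence.from T-∧ (a , b)

T-∨⁻ : ∀ {a b} → T (a ∨ b) → T a ⊎ T b
T-∨⁻ = Equivalence.to T-∨

T-∨⁺ : ∀ {a b} → T a ⊎ T b → T (a ∨ b)
T-∨⁺ = Equivalence.from T-∨

T-not⁺ : ∀ {b} → ¬ T b → T (not b)
T-not⁺ {true}  ¬b = ¬b _
T-not⁺ {false} _  = _

T-not⁻ : ∀ {b} → T (not b) → ¬ T b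
T-not⁻ {false} _ ()

δ : ℕ → ℕ → ℕ
δ j k = bit ⌊ j ≟ k ⌋

δ-yes : ∀ {j k} → j ≡ k → δ j k ≡ 1
δ-yes {j} {k} eq = bit-true (fromWitness {a? = j ≟ k} eq)

δ-no : ∀ {j k} → j ≢ k → δ j k ≡ 0
δ-no {j} {k} ne = bit-false (ne ∘ toWitness {a? = j ≟ k})

sum≡0 : ∀ {k} (f : Fin k → ℕ) → sum f ≡ 0 → ∀ i → f i ≡ 0
sum≡0 f eq zero    = m+n≡0⇒m≡0 (f zero) eq
sum≡0 f eq (suc i) = sum≡0 (f ∘ suc) (m+n≡0⇒n≡0 (f zero) eq) i

sum-zero : ∀ {k} (f : Fin k → ℕ) → (∀ i → f i ≡ 0) → sum f ≡ 0
sum-zero {zero}  f f≡0 = refl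
sum-zero {suc k} f f≡0 = cong₂ _+_ (f≡0 zero) (sum-zero (f ∘ suc) (f≡0 ∘ suc))

sum-single : ∀ {k} (f : Fin k → ℕ) i → (∀ j → j ≢ i → f j ≡ 0) → sum f ≡ f i
sum-single f zero off =
  trans (cong (f zero +_) (sum-zero (f ∘ suc) (λ j → off (suc j) λ ()))) (+-identityʳ _)
sum-single f (suc i) off =
  cong₂ _+_ (off zero λ ())
    (sum-single (f ∘ suc) i (λ j j≢i → off (suc j) (j≢i ∘ F.suc-injective)))

countFin≡sum : ∀ G {k} (P : Fin k → Bool) → countFin G P ≡ sum (λ i → bit (P i))
countFin≡sum G {zero}  P = refl
countFin≡sum G {suc k} P = cong (bit (P zero) +_) (countFin≡sum G (P ∘ suc))

sum-bit-witness : ∀ {k} (P : Fin k → Bool) → sum (λ i → bit (P i)) > 0 → ∃ λ i → T (P i)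
sum-bit-witness P pos with F.any? (λ i → T? (P i))
... | yes w = w
... | no ¬w = contradiction pos
  (<-irrefl (sym (sum-zero _ (λ i → bit-false (λ Pi → ¬w (i , Pi))))))

-- Sums and counts over the vertices of a graph

module _ (G : FinGraph) where

  to : Fin (size G) → V G
  to = Inverse.to (enum G)

  from : V G → Fin (size G)
  from = Inverse.from (enum G)

  to∘from : ∀ x → to (from x) ≡ x
  to∘from x = Inverse.inverseˡ (enum G) refl

  from∘to : ∀ i → from (to i) ≡ i
  from∘to i = Inverse.inverseʳ (enum G) refl

  from-injective : ∀ {x y} → from x ≡ from y → x ≡ y
  from-injective {x} {y} eq = trans (sym (to∘from x)) (trans (cong to eq) (to∘from y))

  eqV⇒≡ : ∀ {x y} → T (eqV G x y) → x ≡ y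
  eqV⇒≡ {x} {y} t = from-injective (toWitness {a? = from x F.≟ from y} t)

  ≡⇒eqV : ∀ {x y} → x ≡ y → T (eqV G x y)
  ≡⇒eqV {x} {y} eq = fromWitness {a? = from x F.≟ from y} (cong from eq)

  _≟V_ : ∀ (x y : V G) → Dec (x ≡ y)
  x ≟V y = map′ from-injective (cong from) (from x F.≟ from y)

  anyFin⁻ : ∀ {k} (P : Fin k → Bool) → T (anyFin G P) → ∃ λ i → T (P i)
  anyFin⁻ {suc k} P t with T-∨⁻ {P zero} t
  ... | inj₁ p = zero , p
  ... | inj₂ q with anyFin⁻ (P ∘ suc) q
  ... | i , Pi = suc i , Pi

  anyFin⁺ : ∀ {k} (P : Fin k → Bool) i → T (P i) → T (anyFin G P)
  anyFin⁺ P zero    p = T-∨⁺ (inj₁ p)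
  anyFin⁺ P (suc i) p = T-∨⁺ {P zero} (inj₂ (anyFin⁺ (P ∘ suc) i p))

  anyV⁻ : ∀ (P : V G → Bool) → T (anyV G P) → ∃ λ x → T (P x)
  anyV⁻ P t with anyFin⁻ (P ∘ to) t
  ... | i , Pi = to i , Pi

  anyV⁺ : ∀ (P : V G → Bool) x → T (P x) → T (anyV G P)
  anyV⁺ P x p = anyFin⁺ (P ∘ to) (from x) (subst (T ∘ P) (sym (to∘from x)) p)

  ∑ : (V G → ℕ) → ℕ
  ∑ f = sum (λ i → f (to i))

  count≡∑ : ∀ P → count G P ≡ ∑ (λ x → bit (P x))
  count≡∑ P = countFin≡sum G (P ∘ to)

  ∑-cong : ∀ {f g} → (∀ x → f x ≡ g x) → ∑ f ≡ ∑ g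
  ∑-cong f≗g = sum-cong-≗ (λ i → f≗g (to i))

  ∑-+ : ∀ f g → ∑ (λ x → f x + g x) ≡ ∑ f + ∑ g
  ∑-+ f g = ∑-distrib-+ (f ∘ to) (g ∘ to)

  ∑-* : ∀ c f → ∑ (λ x → c * f x) ≡ c * ∑ f
  ∑-* c f = sym (*-distribˡ-sum c (f ∘ to))

  ∑-zero : ∀ f → (∀ x → f x ≡ 0) → ∑ f ≡ 0
  ∑-zero f f≡0 = sum-zero (f ∘ to) (λ i → f≡0 (to i))

  ∑≡0 : ∀ f → ∑ f ≡ 0 → ∀ x → f x ≡ 0
  ∑≡0 f eq x = trans (cong f (sym (to∘from x))) (sum≡0 (f ∘ to) eq (from x))

  ∑-single : ∀ f x → (∀ y → y ≢ x → f y ≡ 0) → ∑ f ≡ f x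
  ∑-single f x off = trans
    (sum-single (f ∘ to) (from x)
      (λ i i≢ → off (to i) (λ eq → i≢ (trans (sym (from∘to i)) (cong from eq)))))
    (cong f (to∘from x))

  count-witness : ∀ P → count G P > 0 → ∃ λ x → T (P x)
  count-witness P pos with sum-bit-witness (P ∘ to) (subst (_> 0) (count≡∑ P) pos)
  ... | i , Pi = to i , Pi

  count-positive : ∀ P x → T (P x) → count G P > 0
  count-positive P x Px = n≢0⇒n>0 λ eq →
    bit≡0 (∑≡0 _ (trans (sym (count≡∑ P)) eq) x) Px

  count-single : ∀ P x → T (P x) → (∀ y → T (P y) → y ≡ x) → count G P ≡ 1
  count-single P x Px unique = trans (count≡∑ P)
    (trans (∑-single _ x (λ y y≢x → bit-false (y≢x ∘ unique y))) (bit-true Px))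

  count-pair : ∀ P x y → x ≢ y → T (P x) → T (P y) →
    (∀ z → T (P z) → z ≡ x ⊎ z ≡ y) → count G P ≡ 2
  count-pair P x y x≢y Px Py only = begin
    count G P
      ≡⟨ count≡∑ P ⟩
    ∑ (λ z → bit (P z))
      ≡⟨ ∑-cong split ⟩
    ∑ (λ z → bit (eqV G z x) + bit (eqV G z y))
      ≡⟨ ∑-+ (λ z → bit (eqV G z x)) (λ z → bit (eqV G z y)) ⟩
    ∑ (λ z → bit (eqV G z x)) + ∑ (λ z → bit (eqV G z y))
      ≡⟨ cong₂ _+_ (one x) (one y) ⟩
    2 ∎
    where
    open ≡-Reasoning
    one : ∀ w → ∑ (λ z → bit (eqV G z w)) ≡ 1
    one w = trans (∑-single _ w (λ z z≢w → bit-false (z≢w ∘ eqV⇒≡))) (bit-true (≡⇒eqV refl))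
    split : ∀ z → bit (P z) ≡ bit (eqV G z x) + bit (eqV G z y)
    split z with z ≟V x | z ≟V y
    ... | yes refl | yes refl = ⊥-elim (x≢y refl)
    ... | yes refl | no z≢y = trans (bit-true Px)
      (sym (cong₂ _+_ (bit-true (≡⇒eqV refl)) (bit-false (z≢y ∘ eqV⇒≡))))
    ... | no z≢x | yes refl = trans (bit-true Py)
      (sym (cong₂ _+_ (bit-false (z≢x ∘ eqV⇒≡)) (bit-true (≡⇒eqV refl))))
    ... | no z≢x | no z≢y = trans (bit-false ([ z≢x , z≢y ]′ ∘ only z))
      (sym (cong₂ _+_ (bit-false (z≢x ∘ eqV⇒≡)) (bit-false (z≢y ∘ eqV⇒≡))))

  -- Turns "depends only on the distance" into a numerical function of the distance, the form in
  -- which `DistanceRegular` asks for its parameters. As there are finitely many pairs of vertices,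
  -- a pair with a given value of `h` can be searched for.
  factors-through : (h g : V G → V G → ℕ) →
    (∀ x y x′ y′ → h x y ≡ h x′ y′ → g x y ≡ g x′ y′) →
    Σ (ℕ → ℕ) λ φ → ∀ x y → g x y ≡ φ (h x y)
  factors-through h g wd = φ , correct
    where
    value? : ∀ e → Dec (∃ λ i → ∃ λ j → h (to i) (to j) ≡ e)
    value? e = F.any? (λ i → F.any? (λ j → h (to i) (to j) ≟ e))
    φ : ℕ → ℕ
    φ e with value? e
    ... | yes (i , j , _) = g (to i) (to j)
    -- An arbitrary value at the numbers that `h` does not attain.
    ... | no _            = 0
    correct : ∀ x y → g x y ≡ φ (h x y)
    correct x y with value? (h x y)
    ... | yes (i , j , eq) = wd x y (to i) (to j) (sym eq)
    ... | no ¬v = ⊥-elim (¬v (from x , from y , cong₂ h (to∘from x) (to∘from y)))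

∑-swap : ∀ G H (f : V G → V H → ℕ) →
  ∑ G (λ x → ∑ H (λ y → f x y)) ≡ ∑ H (λ y → ∑ G (λ x → f x y))
∑-swap G H f = ∑-comm (λ i j → f (to G i) (to H j))

-- Distance in a finite graph

-- The bound is returned untested when nothing smaller succeeds. Hence `least-holds` asks that `f`
-- hold at the bound, while `least-≤` does not.
least : (ℕ → Bool) → ℕ → ℕ
least f zero    = 0
least f (suc k) = if f 0 then 0 else suc (least (f ∘ suc) k)

least-holds : ∀ (f : ℕ → Bool) k → T (f k) → T (f (least f k))
least-holds f zero    fk = fk
least-holds f (suc k) fk with f 0 in eq
... | true  = subst T (sym eq) _
... | false = least-holds (f ∘ suc) k fk

least-≤ : ∀ (f : ℕ → Bool) k j → T (f j) → least f k ≤ j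
least-≤ f zero    j fj = z≤n
least-≤ f (suc k) j fj with f 0 in eq
... | true = z≤n
least-≤ f (suc k) zero    fj | false = ⊥-elim (subst T eq fj)
least-≤ f (suc k) (suc j) fj | false = s≤s (least-≤ (f ∘ suc) k j fj)

module _ (G : FinGraph) where

  reach-suc⁻ : ∀ {k x y} → T (reach G (suc k) x y) →
    T (reach G k x y) ⊎ ∃ λ z → T (reach G k x z) × T (adj G z y)
  reach-suc⁻ {k} {x} {y} r with T-∨⁻ {reach G k x y} r
  ... | inj₁ r′ = inj₁ r′
  ... | inj₂ a with anyV⁻ G _ a
  ... | z , rz = inj₂ (z , T-∧⁻ rz)

  reach-weaken : ∀ {k x y} → T (reach G k x y) → T (reach G (suc k) x y)
  reach-weaken r = T-∨⁺ (inj₁ r)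

  reach-snoc : ∀ {k x y z} → T (reach G k x y) → T (adj G y z) → T (reach G (suc k) x z)
  reach-snoc {k} {x} {y} {z} r a = T-∨⁺ {reach G k x z}
    (inj₂ (anyV⁺ G (λ w → reach G k x w ∧ adj G w z) y (T-∧⁺ r a)))

  reach-mono : ∀ {j k x y} → j ≤ k → T (reach G j x y) → T (reach G k x y)
  reach-mono j≤k r = go (≤⇒≤′ j≤k) r
    where
    go : ∀ {j k x y} → j ≤′ k → T (reach G j x y) → T (reach G k x y)
    go (≤′-reflexive refl)    r = r
    go {k = suc k} {x} {y} (≤′-step p) r = reach-weaken {k} {x} {y} (go p r)

  reach-trans : ∀ j k {x y z} → T (reach G j x y) → T (reach G k y z) → T (reach G (k + j) x z)
  reach-trans j zero r s = subst (λ w → T (reach G j _ w)) (eqV⇒≡ G s) r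
  reach-trans j (suc k) {x} {y} {z} r s with reach-suc⁻ {k} {y} {z} s
  ... | inj₁ s′            = reach-weaken {k + j} {x} {z} (reach-trans j k r s′)
  ... | inj₂ (w , s′ , wz) = reach-snoc {k + j} (reach-trans j k r s′) wz

module Distance (G : FinGraph) (isGraph : IsGraph G)
                (D : ℕ) (bounded : ∀ x y → T (reach G D x y)) where

  adj-sym : ∀ {x y} → T (adj G x y) → T (adj G y x)
  adj-sym = subst T (proj₁ isGraph _ _)

  adj-irrefl : ∀ {x y} → T (adj G x y) → x ≢ y
  adj-irrefl a refl = false⇒¬T (proj₂ isGraph _) a

  abstract
    dist : V G → V G → ℕ
    dist x y = least (λ k → reach G k x y) D

    dist-reach : ∀ {x y k} → dist x y ≤ k → T (reach G k x y)
    dist-reach {x} {y} d≤k =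
      reach-mono G d≤k (least-holds (λ k → reach G k x y) D (bounded x y))

    reach-dist : ∀ k {x y} → T (reach G k x y) → dist x y ≤ k
    reach-dist k {x} {y} = least-≤ (λ k → reach G k x y) D k

  dist-≤ : ∀ x y → dist x y ≤ D
  dist-≤ x y = reach-dist D (bounded x y)

  distIs⇒dist : ∀ {x y} k → T (distIs G x y k) → dist x y ≡ k
  distIs⇒dist zero    t = n≤0⇒n≡0 (reach-dist 0 t)
  distIs⇒dist {x} {y} (suc k) t with T-∧⁻ {reach G (suc k) x y} t
  ... | r , ¬r = ≤-antisym (reach-dist (suc k) r) (≰⇒> (T-not⁻ ¬r ∘ dist-reach))

  dist⇒distIs : ∀ {x y} k → dist x y ≡ k → T (distIs G x y k)
  dist⇒distIs zero    eq = dist-reach (≤-reflexive eq)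
  dist⇒distIs {x} {y} (suc k) eq = T-∧⁺ {reach G (suc k) x y} (dist-reach (≤-reflexive eq))
    (T-not⁺ (λ r → <⇒≱ (≤-reflexive (sym eq)) (reach-dist k r)))

  bit-distIs : ∀ x y k → bit (distIs G x y k) ≡ δ (dist x y) k
  bit-distIs x y k = bit-⇔ (fromWitness {a? = dist x y ≟ k} ∘ distIs⇒dist k)
    (dist⇒distIs k ∘ toWitness {a? = dist x y ≟ k})

  dist-refl : ∀ x → dist x x ≡ 0
  dist-refl x = n≤0⇒n≡0 (reach-dist 0 (≡⇒eqV G refl))

  dist≡0⇒≡ : ∀ {x y} → dist x y ≡ 0 → x ≡ y
  dist≡0⇒≡ eq = eqV⇒≡ G (dist-reach {k = 0} (≤-reflexive eq))

  dist-triangle : ∀ x y z → dist x z ≤ dist x y + dist y z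
  dist-triangle x y z = subst (dist x z ≤_) (+-comm (dist y z) (dist x y))
    (reach-dist (dist y z + dist x y)
      (reach-trans G (dist x y) (dist y z) (dist-reach ≤-refl) (dist-reach ≤-refl)))

  reach-1 : ∀ {x y} → T (adj G x y) → T (reach G 1 x y)
  reach-1 = reach-snoc G {0} (≡⇒eqV G refl)

  dist-adj : ∀ {x y} → T (adj G x y) → dist x y ≡ 1
  dist-adj a = ≤-antisym (reach-dist 1 (reach-1 a)) (n≢0⇒n>0 (adj-irrefl a ∘ dist≡0⇒≡))

  dist-step : ∀ x {y z} → T (adj G y z) → dist x z ≤ suc (dist x y)
  dist-step x {y} {z} a = reach-dist (suc (dist x y)) (reach-snoc G {dist x y} (dist-reach ≤-refl) a)

  reach-sym : ∀ k {x y} → T (reach G k x y) → T (reach G k y x)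
  reach-sym zero r = ≡⇒eqV G (sym (eqV⇒≡ G r))
  reach-sym (suc k) {x} {y} r with reach-suc⁻ G {k} {x} {y} r
  ... | inj₁ r′ = reach-weaken G {k} {y} {x} (reach-sym k r′)
  ... | inj₂ (z , r′ , zy) = subst (λ j → T (reach G j y x)) (+-comm k 1)
    (reach-trans G 1 k (reach-1 (adj-sym zy)) (reach-sym k r′))

  dist-sym : ∀ x y → dist x y ≡ dist y x
  dist-sym x y = ≤-antisym (half x y) (half y x)
    where
    half : ∀ x y → dist x y ≤ dist y x
    half x y = reach-dist (dist y x) (reach-sym (dist y x) (dist-reach ≤-refl))

  dist-pred : ∀ x {y} e → dist x y ≡ suc e → ∃ λ z → dist x z ≡ e × T (adj G z y)
  dist-pred x {y} e eq with reach-suc⁻ G {e} {x} {y} (dist-reach (≤-reflexive eq))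
  ... | inj₁ r = contradiction (reach-dist e r) (<⇒≱ (≤-reflexive (sym eq)))
  ... | inj₂ (z , r , zy) = z
    , ≤-antisym (reach-dist e r) (s≤s⁻¹ (subst (_≤ suc (dist x z)) eq (dist-step x zy))) , zy

  -- For d = `dist x y` and k = d - 1, d, d + 1 these are the intersection numbers c_d, a_d, b_d.
  -- Indexing by the radius k keeps the three cases together in the double count.
  neighboursAt : ℕ → V G → V G → ℕ
  neighboursAt k x y = ∑ G (λ z → bit (adj G y z) * δ (dist x z) k)

  count≡neighboursAt : ∀ k x y →
    count G (λ z → distIs G x z k ∧ adj G y z) ≡ neighboursAt k x y
  count≡neighboursAt k x y = trans (count≡∑ G (λ z → distIs G x z k ∧ adj G y z)) (∑-cong G λ z →
    trans (bit-∧ (distIs G x z k) (adj G y z))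
      (trans (cong (_* bit (adj G y z)) (bit-distIs x z k)) (*-comm (δ (dist x z) k) _)))

-- Coverings described by unique lifting of edges

-- A local form of `IsCover`: edges lift uniquely from a given end, and a path of length two closes
-- to a triangle when the images of its ends are adjacent. This form yields lifted paths directly
-- and is easy to check on a graph given by a permutation rule.
record IsCovering (G H : FinGraph) (π : V H → V G) : Set where
  field
    base-isGraph : IsGraph G
    isGraph      : IsGraph H
    surjective   : ∀ v → ∃ λ x → π x ≡ v
    hom          : ∀ {x y} → T (adj H x y) → T (adj G (π x) (π y))
    lift         : ∀ x {w} → T (adj G (π x) w) → ∃ λ y → T (adj H x y) × π y ≡ w
    lift-unique  : ∀ {x y z} → T (adj H x y) → T (adj H x z) → π y ≡ π z → y ≡ z
    lift-triangle : ∀ {x y z} → T (adj H x y) → T (adj H x z) →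
      T (adj G (π y) (π z)) → T (adj H y z)

  base-irrefl : ∀ {v w} → T (adj G v w) → v ≢ w
  base-irrefl a refl = false⇒¬T (proj₂ base-isGraph _) a

  base-sym : ∀ {v w} → T (adj G v w) → T (adj G w v)
  base-sym = subst T (proj₁ base-isGraph _ _)

module _ {G H : FinGraph} {π : V H → V G} (C : IsCovering G H π) where
  open IsCovering C

  private
    non-adj : ∀ {x y} → ¬ T (adj G (π x) (π y)) → adj H x y ≡ false
    non-adj ¬a = ¬T⇒false (¬a ∘ hom)

    -- The fibre of `x` itself contributes no neighbour, since `G` has no loops; the fibre over `w`
    -- contributes the unique lift.
    one-lift : (S : V H → Bool) → ∀ x w → T (adj G (π x) w) →
      (∀ y → π y ≡ w → T (S y)) → (∀ y → T (S y) → π y ≡ w ⊎ π y ≡ π x) →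
      count H (λ y → S y ∧ adj H x y) ≡ 1
    one-lift S x w xw S⊇ S⊆ with lift x xw
    ... | y , xy , πy = count-single H _ y (T-∧⁺ (S⊇ y πy) xy) only
      where
      only : ∀ z → T (S z ∧ adj H x z) → z ≡ y
      only z t with T-∧⁻ {S z} t
      ... | Sz , xz with S⊆ z Sz
      ... | inj₁ πz = lift-unique xz xy (trans πz (sym πy))
      ... | inj₂ πz = ⊥-elim (base-irrefl (hom xz) (sym πz))

    two-lifts : (S : V H → Bool) → ∀ x v w →
      T (adj G (π x) v) → T (adj G (π x) w) → v ≢ w →
      (∀ y → π y ≡ v ⊎ π y ≡ w → T (S y)) →
      (∀ y → T (S y) → π y ≡ π x ⊎ π y ≡ v ⊎ π y ≡ w) →
      count H (λ y → S y ∧ adj H x y) ≡ 2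
    two-lifts S x v w xv xw v≢w S⊇ S⊆ with lift x xv | lift x xw
    ... | y , xy , πy | z , xz , πz = count-pair H _ y z
      (λ y≡z → v≢w (trans (sym πy) (trans (cong π y≡z) πz)))
      (T-∧⁺ (S⊇ y (inj₁ πy)) xy) (T-∧⁺ (S⊇ z (inj₂ πz)) xz) only
      where
      only : ∀ u → T (S u ∧ adj H x u) → u ≡ y ⊎ u ≡ z
      only u t with T-∧⁻ {S u} t
      ... | Su , xu with S⊆ u Su
      ... | inj₁ πu        = ⊥-elim (base-irrefl (hom xu) (sym πu))
      ... | inj₂ (inj₁ πu) = inj₁ (lift-unique xu xy (trans πu (sym πy)))
      ... | inj₂ (inj₂ πu) = inj₂ (lift-unique xu xz (trans πu (sym πz)))

    in-fibres₂ : ∀ {v w x} → T (fibre G H π v x ∨ fibre G H π w x) → π x ≡ v ⊎ π x ≡ w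
    in-fibres₂ {v} {w} {x} t with T-∨⁻ {eqV G (π x) v} t
    ... | inj₁ p = inj₁ (eqV⇒≡ G p)
    ... | inj₂ q = inj₂ (eqV⇒≡ G q)

    fibres₂-in : ∀ {v w x} → π x ≡ v ⊎ π x ≡ w → T (fibre G H π v x ∨ fibre G H π w x)
    fibres₂-in (inj₁ p) = T-∨⁺ (inj₁ (≡⇒eqV G p))
    fibres₂-in {v} {w} {x} (inj₂ q) = T-∨⁺ {eqV G (π x) v} (inj₂ (≡⇒eqV G q))

    in-fibres₃ : ∀ {u v w x} → T (fibre G H π u x ∨ fibre G H π v x ∨ fibre G H π w x) →
      π x ≡ u ⊎ π x ≡ v ⊎ π x ≡ w
    in-fibres₃ {u} {v} {w} {x} t with T-∨⁻ {eqV G (π x) u} t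
    ... | inj₁ p = inj₁ (eqV⇒≡ G p)
    ... | inj₂ q = inj₂ (in-fibres₂ {v} {w} {x} q)

    fibres₃-in : ∀ {u v w x} → π x ≡ u ⊎ π x ≡ v ⊎ π x ≡ w →
      T (fibre G H π u x ∨ fibre G H π v x ∨ fibre G H π w x)
    fibres₃-in (inj₁ p) = T-∨⁺ (inj₁ (≡⇒eqV G p))
    fibres₃-in {u} {v} {w} {x} (inj₂ q) = T-∨⁺ {eqV G (π x) u} (inj₂ (fibres₂-in {v} {w} {x} q))

  covering⇒cover : IsCover G H π
  covering⇒cover = record
    { isGraph           = isGraph
    ; surjective        = surjective
    ; fibreCoclique     = λ v x y Sx Sy → non-adj λ a →
        base-irrefl a (trans (eqV⇒≡ G Sx) (sym (eqV⇒≡ G Sy)))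
    ; nonEdgeCoclique   = λ v w _ vw x y Sx Sy → non-adj λ a →
        nonEdge v w (false⇒¬T vw) a (in-fibres₂ {v} {w} {x} Sx) (in-fibres₂ {v} {w} {y} Sy)
    ; edgeMatching      = edge
    ; triangleTriangles = triangle
    }
    where
    nonEdge : ∀ v w → ¬ T (adj G v w) → ∀ {p q} → T (adj G p q) →
      p ≡ v ⊎ p ≡ w → ¬ (q ≡ v ⊎ q ≡ w)
    nonEdge v w ¬vw pq (inj₁ refl) (inj₁ refl) = base-irrefl pq refl
    nonEdge v w ¬vw pq (inj₁ refl) (inj₂ refl) = ¬vw pq
    nonEdge v w ¬vw pq (inj₂ refl) (inj₁ refl) = ¬vw (base-sym pq)
    nonEdge v w ¬vw pq (inj₂ refl) (inj₂ refl) = base-irrefl pq refl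

    edge : ∀ v w → T (adj G v w) →
      PerfectMatching H (λ x → fibre G H π v x ∨ fibre G H π w x)
    edge v w vw x Sx with in-fibres₂ {v} {w} {x} Sx
    ... | inj₁ refl = one-lift _ x w vw
      (λ y πy → fibres₂-in {π x} {w} {y} (inj₂ πy))
      (λ y Sy → [ inj₂ , inj₁ ]′ (in-fibres₂ {π x} {w} {y} Sy))
    ... | inj₂ refl = one-lift _ x v (base-sym vw)
      (λ y πy → fibres₂-in {v} {π x} {y} (inj₁ πy))
      (λ y Sy → in-fibres₂ {v} {π x} {y} Sy)

    triangle : ∀ u v w → T (adj G u v) → T (adj G v w) → T (adj G u w) →
      DisjointUnionOfTriangles H
        (λ x → fibre G H π u x ∨ fibre G H π v x ∨ fibre G H π w x)
    triangle u v w uv vw uw = degree , transitive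
      where
      S : V H → Bool
      S x = fibre G H π u x ∨ fibre G H π v x ∨ fibre G H π w x
      S⁻ : ∀ x → T (S x) → π x ≡ u ⊎ π x ≡ v ⊎ π x ≡ w
      S⁻ x = in-fibres₃ {u} {v} {w} {x}
      S⁺ : ∀ x → π x ≡ u ⊎ π x ≡ v ⊎ π x ≡ w → T (S x)
      S⁺ x = fibres₃-in {u} {v} {w} {x}

      degree : ∀ x → T (S x) → count H (λ y → S y ∧ adj H x y) ≡ 2
      degree x Sx with S⁻ x Sx
      ... | inj₁ refl = two-lifts S x v w uv uw (base-irrefl vw)
        (λ y → S⁺ y ∘ inj₂) S⁻
      ... | inj₂ (inj₁ refl) = two-lifts S x u w (base-sym uv) vw (base-irrefl uw)
        (λ y → S⁺ y ∘ [ inj₁ , inj₂ ∘ inj₂ ]′)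
        (λ y → [ inj₂ ∘ inj₁ , [ inj₁ , inj₂ ∘ inj₂ ]′ ]′ ∘ S⁻ y)
      ... | inj₂ (inj₂ refl) = two-lifts S x u v (base-sym uw) (base-sym vw) (base-irrefl uv)
        (λ y → S⁺ y ∘ [ inj₁ , inj₂ ∘ inj₁ ]′)
        (λ y → [ inj₂ ∘ inj₁ , [ inj₂ ∘ inj₂ , inj₁ ]′ ]′ ∘ S⁻ y)

      pairwise : ∀ {p q} → p ≡ u ⊎ p ≡ v ⊎ p ≡ w → q ≡ u ⊎ q ≡ v ⊎ q ≡ w →
        p ≢ q → T (adj G p q)
      pairwise (inj₁ refl)        (inj₁ refl)        p≢q = ⊥-elim (p≢q refl)
      pairwise (inj₁ refl)        (inj₂ (inj₁ refl)) p≢q = uv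
      pairwise (inj₁ refl)        (inj₂ (inj₂ refl)) p≢q = uw
      pairwise (inj₂ (inj₁ refl)) (inj₁ refl)        p≢q = base-sym uv
      pairwise (inj₂ (inj₁ refl)) (inj₂ (inj₁ refl)) p≢q = ⊥-elim (p≢q refl)
      pairwise (inj₂ (inj₁ refl)) (inj₂ (inj₂ refl)) p≢q = vw
      pairwise (inj₂ (inj₂ refl)) (inj₁ refl)        p≢q = base-sym uw
      pairwise (inj₂ (inj₂ refl)) (inj₂ (inj₁ refl)) p≢q = base-sym vw
      pairwise (inj₂ (inj₂ refl)) (inj₂ (inj₂ refl)) p≢q = ⊥-elim (p≢q refl)

      transitive : ∀ x y z → T (S x) → T (S y) → T (S z) →
        T (adj H x y) → T (adj H x z) → T (not (eqV H y z)) → T (adj H y z)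
      transitive x y z _ Sy Sz xy xz y≢z = lift-triangle xy xz
        (pairwise (S⁻ y Sy) (S⁻ z Sz) (T-not⁻ y≢z ∘ ≡⇒eqV H ∘ lift-unique xy xz))

  reach-project : ∀ k {x y} → T (reach H k x y) → T (reach G k (π x) (π y))
  reach-project zero r = ≡⇒eqV G (cong π (eqV⇒≡ H r))
  reach-project (suc k) {x} {y} r with reach-suc⁻ H {k} {x} {y} r
  ... | inj₁ r′           = reach-weaken G {k} {π x} {π y} (reach-project k r′)
  ... | inj₂ (z , r′ , a) = reach-snoc G {k} (reach-project k r′) (hom a)

  reach-lift : ∀ k x {w} → T (reach G k (π x) w) → ∃ λ y → T (reach H k x y) × π y ≡ w
  reach-lift zero x r = x , ≡⇒eqV H refl , eqV⇒≡ G r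
  reach-lift (suc k) x {w} r with reach-suc⁻ G {k} {π x} {w} r
  ... | inj₁ r′ with reach-lift k x r′
  ... | y , ry , πy = y , reach-weaken H {k} {x} {y} ry , πy
  reach-lift (suc k) x {w} r | inj₂ (v , r′ , a) with reach-lift k x r′
  ... | y , ry , refl with lift y a
  ... | z , yz , πz = z , reach-snoc H {k} ry yz , πz

  -- Unique lifting as an equation of numbers: a vertex has one neighbour in each fibre over a
  -- neighbour of its image and none in any other. This lets the edges in the double count be
  -- collected from either end.
  neighbour-lifts : ∀ z b →
    ∑ H (λ y → bit (eqV G (π y) b) * bit (adj H z y)) ≡ bit (adj G (π z) b)
  neighbour-lifts z b with T? (adj G (π z) b)
  ... | yes a with lift z a
  ... | y , zy , refl = trans
    (∑-single H _ y λ w w≢y → off w w≢y)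
    (trans (cong₂ _*_ (bit-true (≡⇒eqV G refl)) (bit-true zy)) (sym (bit-true a)))
    where
    off : ∀ w → w ≢ y → bit (eqV G (π w) (π y)) * bit (adj H z w) ≡ 0
    off w w≢y = trans (sym (bit-∧ (eqV G (π w) (π y)) (adj H z w)))
      (bit-false λ t → let (e , zw) = T-∧⁻ {eqV G (π w) (π y)} t in
        w≢y (lift-unique zw zy (eqV⇒≡ G e)))
  neighbour-lifts z b | no ¬a = trans
    (∑-zero H _ λ y → trans (sym (bit-∧ (eqV G (π y) b) (adj H z y)))
      (bit-false λ t → let (e , zy) = T-∧⁻ {eqV G (π y) b} t in
        ¬a (subst (T ∘ adj G (π z)) (eqV⇒≡ G e) (hom zy))))
    (sym (bit-false ¬a))

-- Intersection numbers and antipodes in a distance-regular graph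

module DistanceRegularity (H : FinGraph) (isGraph : IsGraph H) (D : ℕ)
         (bounded : ∀ x y → T (reach H D x y)) (regular : DistanceRegular H) where

  open Distance H isGraph D bounded

  private
    b c : ℕ → ℕ
    b = proj₁ (proj₂ regular)
    c = proj₁ (proj₂ (proj₂ regular))

  private
    above : ∀ x y k → dist x y ≡ k → neighboursAt (suc k) x y ≡ b k
    above x y k eq = trans (sym (count≡neighboursAt (suc k) x y))
      (proj₁ (proj₂ (proj₂ (proj₂ regular))) k x y (dist⇒distIs k eq))

    below : ∀ x y k → dist x y ≡ suc k → neighboursAt k x y ≡ c (suc k)
    below x y k eq = trans (sym (count≡neighboursAt k x y))
      (proj₂ (proj₂ (proj₂ (proj₂ regular))) k x y (dist⇒distIs (suc k) eq))

    neighbour-dist : ∀ x {y z} → T (adj H y z) →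
      dist x z ≤ suc (dist x y) × dist x y ≤ suc (dist x z)
    neighbour-dist x yz = dist-step x yz , dist-step x (adj-sym yz)

    vanish : ∀ x y k → (∀ {z} → T (adj H y z) → dist x z ≢ k) → neighboursAt k x y ≡ 0
    vanish x y k off = ∑-zero H _ summand
      where
      summand : ∀ z → bit (adj H y z) * δ (dist x z) k ≡ 0
      summand z with T? (adj H y z)
      ... | yes yz = trans (cong (bit (adj H y z) *_) (δ-no (off yz))) (*-zeroʳ (bit (adj H y z)))
      ... | no ¬yz = cong (_* δ (dist x z) k) (bit-false ¬yz)

    valency : ∀ y → ∑ H (λ z → bit (adj H y z)) ≡ b 0
    valency y = trans (∑-cong H summand) (above y y 0 (dist-refl y))
      where
      summand : ∀ z → bit (adj H y z) ≡ bit (adj H y z) * δ (dist y z) 1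
      summand z with T? (adj H y z)
      ... | yes yz = sym (trans (cong (bit (adj H y z) *_) (δ-yes (dist-adj yz))) (*-identityʳ _))
      ... | no ¬yz = trans (bit-false ¬yz) (cong (_* δ (dist y z) 1) (sym (bit-false ¬yz)))

    three-levels : ∀ e d → d ≤ 2 + e → e ≤ d → δ d e + δ d (1 + e) + δ d (2 + e) ≡ 1
    three-levels e d d≤ e≤ with d ≟ e | d ≟ 1 + e | d ≟ 2 + e
    ... | yes refl | yes ()   | _
    ... | yes refl | _        | yes ()
    ... | yes refl | no d≢1+e | no d≢2+e = refl
    ... | no d≢e   | yes refl | yes ()
    ... | no d≢e   | yes refl | no d≢2+e = refl
    ... | no d≢e   | no d≢1+e | yes refl = refl
    ... | no d≢e   | no d≢1+e | no d≢2+e =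
      ⊥-elim (d≢2+e (≤-antisym d≤ (≤∧≢⇒< (≤∧≢⇒< e≤ (d≢e ∘ sym)) (d≢1+e ∘ sym))))

    levels-sum : ∀ x y e → dist x y ≡ suc e →
      neighboursAt e x y + neighboursAt (1 + e) x y + neighboursAt (2 + e) x y ≡ b 0
    levels-sum x y e eq = begin
      ∑ H (N e) + ∑ H (N (1 + e)) + ∑ H (N (2 + e))
        ≡⟨ cong (_+ ∑ H (N (2 + e))) (∑-+ H (N e) (N (1 + e))) ⟨
      ∑ H (λ z → N e z + N (1 + e) z) + ∑ H (N (2 + e))
        ≡⟨ ∑-+ H (λ z → N e z + N (1 + e) z) (N (2 + e)) ⟨
      ∑ H (λ z → N e z + N (1 + e) z + N (2 + e) z)
        ≡⟨ ∑-cong H summand ⟩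
      ∑ H (λ z → bit (adj H y z))
        ≡⟨ valency y ⟩
      b 0 ∎
      where
      open ≡-Reasoning
      N : ℕ → V H → ℕ
      N k z = bit (adj H y z) * δ (dist x z) k
      summand : ∀ z → N e z + N (1 + e) z + N (2 + e) z ≡ bit (adj H y z)
      summand z with T? (adj H y z)
      ... | no ¬yz = trans (cong (λ a → a * δ (dist x z) e + a * δ (dist x z) (1 + e)
        + a * δ (dist x z) (2 + e)) (bit-false ¬yz)) (sym (bit-false ¬yz))
      ... | yes yz with neighbour-dist x yz
      ... | up , down = begin
        a * d₀ + a * d₁ + a * d₂ ≡⟨ cong (_+ a * d₂) (*-distribˡ-+ a d₀ d₁) ⟨
        a * (d₀ + d₁) + a * d₂   ≡⟨ *-distribˡ-+ a (d₀ + d₁) d₂ ⟨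
        a * (d₀ + d₁ + d₂)       ≡⟨ cong (a *_) (three-levels e (dist x z)
                                      (subst (λ d → dist x z ≤ suc d) eq up)
                                      (s≤s⁻¹ (subst (_≤ suc (dist x z)) eq down))) ⟩
        a * 1                    ≡⟨ *-identityʳ a ⟩
        a                        ∎
        where
        a d₀ d₁ d₂ : ℕ
        a = bit (adj H y z)
        d₀ = δ (dist x z) e
        d₁ = δ (dist x z) (1 + e)
        d₂ = δ (dist x z) (2 + e)

    too-far : ∀ x y k → suc (dist x y) < k → neighboursAt k x y ≡ 0
    too-far x y k far = vanish x y k λ yz eq →
      <⇒≱ far (subst (_≤ suc (dist x y)) eq (proj₁ (neighbour-dist x yz)))

    too-near : ∀ x y k → suc k < dist x y → neighboursAt k x y ≡ 0
    too-near x y k near = vanish x y k λ yz eq →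
      <⇒≱ near (subst (λ d → dist x y ≤ suc d) eq (proj₂ (neighbour-dist x yz)))

    -- `DistanceRegular` prescribes b and c only; the remaining number is a_d = b_0 - b_d - c_d,
    -- obtained here by cancellation. The valency is `b 0` because the neighbours of a vertex are
    -- the vertices at distance 1 from it. Distance 0 has no level below it and is settled by the
    -- absence of loops.
    level : ∀ x y x′ y′ e → dist x y ≡ e → dist x′ y′ ≡ e →
      neighboursAt e x y ≡ neighboursAt e x′ y′
    level x y x′ y′ zero eq eq′ = trans (none x y eq) (sym (none x′ y′ eq′))
      where
      none : ∀ x y → dist x y ≡ 0 → neighboursAt 0 x y ≡ 0
      none x y eq = vanish x y 0 λ yz eq₂ →
        adj-irrefl yz (trans (sym (dist≡0⇒≡ eq)) (dist≡0⇒≡ eq₂))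
    level x y x′ y′ (suc e) eq eq′ = +-cancelˡ-≡ (neighboursAt e x y) _ _
      (+-cancelʳ-≡ (neighboursAt (2 + e) x y) _ _ (begin
        neighboursAt e x y + neighboursAt (1 + e) x y + neighboursAt (2 + e) x y
          ≡⟨ trans (levels-sum x y e eq) (sym (levels-sum x′ y′ e eq′)) ⟩
        neighboursAt e x′ y′ + neighboursAt (1 + e) x′ y′ + neighboursAt (2 + e) x′ y′
          ≡⟨ cong₂ (λ l r → l + neighboursAt (1 + e) x′ y′ + r)
               (trans (below x′ y′ e eq′) (sym (below x y e eq)))
               (trans (above x′ y′ (suc e) eq′) (sym (above x y (suc e) eq))) ⟩
        neighboursAt e x y + neighboursAt (1 + e) x′ y′ + neighboursAt (2 + e) x y ∎))
      where open ≡-Reasoning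

  neighboursAt-regular : ∀ k x y x′ y′ → dist x y ≡ dist x′ y′ →
    neighboursAt k x y ≡ neighboursAt k x′ y′
  neighboursAt-regular k x y x′ y′ eq with <-cmp k (dist x y)
  ... | tri≈ _ k≡d _ = level x y x′ y′ k (sym k≡d) (trans (sym eq) (sym k≡d))
  ... | tri< k<d _ _ with suc k ≟ dist x y
  ... | yes d≡ = trans (below x y k (sym d≡)) (sym (below x′ y′ k (trans (sym eq) (sym d≡))))
  ... | no d≢ = trans (too-near x y k near) (sym (too-near x′ y′ k (subst (suc k <_) eq near)))
    where near = ≤∧≢⇒< k<d d≢
  neighboursAt-regular k x y x′ y′ eq | tri> _ _ d<k with suc (dist x y) ≟ k
  ... | yes refl = trans (above x y _ refl) (sym (above x′ y′ _ (sym eq)))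
  ... | no k≢ = trans (too-far x y k far)
                      (sym (too-far x′ y′ k (subst (λ d → suc d < k) eq far)))
    where far = ≤∧≢⇒< d<k k≢

  module _ {u w : V H} (diametral : dist u w ≡ D) where

    private abstract
      at-distance : ∀ j e → e + j ≡ D → ∃ λ v → dist u v ≡ e
      at-distance zero    e eq = w , trans diametral (trans (sym eq) (+-identityʳ e))
      at-distance (suc j) e eq with at-distance j (suc e) (trans (sym (+-suc e j)) eq)
      ... | v , uv with dist-pred u e uv
      ... | v′ , uv′ , _ = v′ , uv′

      -- This says b_d > 0 for d < D. Walking back from `w` towards `u` meets an edge `v′ v` that
      -- climbs from distance d to d + 1 from `u`, and regularity carries the positive count at
      -- `(u , v′)` over to `(x , y)`.
      extend : ∀ x y → dist x y < D → ∃ λ z → dist x z ≡ suc (dist x y) × T (adj H y z)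
      extend x y d<D with at-distance (D ∸ suc (dist x y)) (suc (dist x y)) (m+[n∸m]≡n d<D)
      ... | v , uv with dist-pred u (dist x y) uv
      ... | v′ , uv′ , v′v = neighbour (count-witness H (sphere x y) positive)
        where
        e : ℕ
        e = suc (dist x y)
        sphere : V H → V H → V H → Bool
        sphere x y z = distIs H x z e ∧ adj H y z
        same : count H (sphere u v′) ≡ count H (sphere x y)
        same = trans (count≡neighboursAt e u v′)
          (trans (neighboursAt-regular e u v′ x y uv′) (sym (count≡neighboursAt e x y)))
        positive : count H (sphere x y) > 0
        positive = subst (_> 0) same
          (count-positive H (sphere u v′) v (T-∧⁺ (dist⇒distIs e uv) v′v))
        neighbour : ∃ (λ z → T (sphere x y z)) → ∃ λ z → dist x z ≡ e × T (adj H y z)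
        neighbour (z , t) = z , distIs⇒dist e (proj₁ (T-∧⁻ {distIs H x z e} t))
          , proj₂ (T-∧⁻ {distIs H x z e} t)

    private
      extend-to-D : ∀ j x y → j + dist x y ≡ D → ∃ λ z → dist x z ≡ D × dist y z ≤ j
      extend-to-D zero    x y eq = y , eq , ≤-reflexive (dist-refl y)
      extend-to-D (suc j) x y eq =
        let d<D = subst (dist x y <_) eq (s≤s (m≤n+m (dist x y) j))
            y′ , xy′ , yy′ = extend x y d<D
            eq′ = trans (cong (j +_) xy′) (trans (+-suc j (dist x y)) eq)
            z , xz , y′z = extend-to-D j x y′ eq′
        in z , xz , ≤-trans (dist-triangle y y′ z) (+-mono-≤ (≤-reflexive (dist-adj yy′)) y′z)

    -- A geodesic from `y` to `x` is prolonged beyond `x` until it has length D. `extend-to-D` only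
    -- bounds the length of the added piece from above; the triangle inequality supplies the other
    -- bound.
    antipode : ∀ x y → ∃ λ z → dist y z ≡ D × dist x y + dist x z ≡ D
    antipode x y with extend-to-D (D ∸ dist y x) y x (m∸n+n≡m (dist-≤ y x))
    ... | z , yz , xz = z , yz , ≤-antisym
      (≤-trans (+-mono-≤ (≤-reflexive (dist-sym x y)) xz) (≤-reflexive (m+[n∸m]≡n (dist-≤ y x))))
      (≤-trans (≤-reflexive (sym yz)) (≤-trans (dist-triangle y x z)
        (+-monoˡ-≤ (dist x z) (≤-reflexive (dist-sym y x)))))

-- Quotients whose fibres lie inside antipodal classes

module AntipodalQuotient {G H : FinGraph} {π : V H → V G} (C : IsCovering G H π)
         (D : ℕ) (bounded : ∀ x y → T (reach H D x y))
         {W : Set} (θ : V G → W)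
         (antipodal⁻ : ∀ {x y} → θ (π x) ≡ θ (π y) → x ≢ y → T (distIs H x y D))
         (antipodal⁺ : ∀ {x y} → T (distIs H x y D) → θ (π x) ≡ θ (π y)) where

  open IsCovering C

  base-bounded : ∀ a b → T (reach G D a b)
  base-bounded a b with surjective a | surjective b
  ... | x , refl | y , refl = reach-project C D (bounded x y)

  open Distance H isGraph D bounded
  module Base = Distance G base-isGraph D base-bounded

  dist-project : ∀ x y → Base.dist (π x) (π y) ≤ dist x y
  dist-project x y = Base.reach-dist _ (reach-project C (dist x y) (dist-reach ≤-refl))

  -- A geodesic of `G` starting at `π x` lifts to a path of the same length starting at `x`, and
  -- projection never increases distances.
  nearest : ∀ x b → ∃ λ y → π y ≡ b × dist x y ≡ Base.dist (π x) b
  nearest x b with reach-lift C (Base.dist (π x) b) x (Base.dist-reach ≤-refl)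
  ... | y , r , refl = y , refl , ≤-antisym (reach-dist _ r) (dist-project x y)

  -- The nearest lift of `b` differs from `x` and shares its antipodal class, so it is at distance
  -- D, and this distance is the one in `G`.
  fibre⇒antipodal : ∀ {a b} → θ a ≡ θ b → a ≢ b → T (distIs G a b D)
  fibre⇒antipodal {a} {b} θ≡ a≢b with surjective a
  ... | x , refl with nearest x b
  ... | y , refl , xy = Base.dist⇒distIs D
    (trans (sym xy) (distIs⇒dist D (antipodal⁻ θ≡ (a≢b ∘ cong π))))

  antipodal⇒fibre : ∀ {a b} → T (distIs G a b D) → θ a ≡ θ b
  antipodal⇒fibre {a} {b} ab with surjective a
  ... | x , refl with nearest x b
  ... | y , refl , xy = antipodal⁺ (dist⇒distIs D (trans xy (Base.distIs⇒dist D ab)))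

  module _ (regular : DistanceRegular H) {u w : V H} (diametral : T (distIs H u w D))
           {p : ℕ} (fibre-size : ∀ b → count H (fibre G H π b) ≡ suc p) where

    open DistanceRegularity H isGraph D bounded regular

    -- The antipode z of y′ with respect to x satisfies d(x,y′) + d(x,z) = D and
    -- lies in the antipodal class of y; either z = y, or d(y,z) = D forces
    -- d(x,y′) ≤ d(x,y).
    dist-in-block : ∀ x y y′ → dist x y ≡ Base.dist (π x) (π y) → π y′ ≡ π y → y′ ≢ y →
      dist x y′ ≡ dist x y ⊔ (D ∸ dist x y)
    dist-in-block x y y′ nearest-y πy′ y′≢y
      with antipode (distIs⇒dist D diametral) x y′
    ... | z , y′z , sum≡D = by-cases (_≟V_ H z y)
      where
      i≤j : dist x y ≤ dist x y′
      i≤j = subst (_≤ dist x y′) (trans (cong (Base.dist (π x)) πy′) (sym nearest-y))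
              (dist-project x y′)
      apart : ∀ v v′ → θ (π v) ≡ θ (π v′) → v ≢ v′ → D ≤ dist x v + dist x v′
      apart v v′ θ≡ v≢v′ = begin
        D                     ≡⟨ distIs⇒dist D (antipodal⁻ θ≡ v≢v′) ⟨
        dist v v′             ≤⟨ dist-triangle v x v′ ⟩
        dist v x + dist x v′  ≡⟨ cong (_+ dist x v′) (dist-sym v x) ⟩
        dist x v + dist x v′  ∎
        where open ≤-Reasoning
      by-cases : Dec (z ≡ y) → dist x y′ ≡ dist x y ⊔ (D ∸ dist x y)
      by-cases (yes z≡y) = trans j≡D∸i (sym (m≤n⇒m⊔n≡n (subst (dist x y ≤_) j≡D∸i i≤j)))
        where
        j≡D∸i : dist x y′ ≡ D ∸ dist x y
        j≡D∸i = trans (sym (m+n∸n≡m (dist x y′) (dist x y)))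
          (cong (_∸ dist x y) (trans (cong (λ v → dist x y′ + dist x v) (sym z≡y)) sum≡D))
      by-cases (no z≢y) = trans j≡i (sym (m≥n⇒m⊔n≡m (m≤n+o⇒m∸n≤o D (dist x y) D≤2i)))
        where
        z-class : θ (π z) ≡ θ (π y)
        z-class = trans (sym (antipodal⁺ (dist⇒distIs D y′z))) (cong θ πy′)
        j≤i : dist x y′ ≤ dist x y
        j≤i = +-cancelʳ-≤ (dist x z) _ _ (≤-trans (≤-reflexive sum≡D)
          (≤-trans (apart z y z-class z≢y) (≤-reflexive (+-comm (dist x z) (dist x y)))))
        j≡i : dist x y′ ≡ dist x y
        j≡i = ≤-antisym j≤i i≤j
        D≤2i : D ≤ dist x y + dist x y
        D≤2i = subst (λ j → D ≤ j + dist x y) j≡i (apart y′ y (cong θ πy′) y′≢y)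

    -- Counting edges between a fibre and a sphere

    [_∈_] : V H → V G → ℕ
    [ y ∈ b ] = bit (eqV G (π y) b)

    block-size : ∀ b → ∑ H [_∈ b ] ≡ suc p
    block-size b = trans (sym (count≡∑ H (fibre G H π b))) (fibre-size b)

    -- To avoid subtraction, `v` is added at the point `y`: on the fibre, `f` plus `v` at `y` agrees
    -- with the constant `v` plus `f y` at `y`. The constant sums to (1 + p) v.
    ∑-block : ∀ (f : V H → ℕ) y v → (∀ y′ → π y′ ≡ π y → y′ ≢ y → f y′ ≡ v) →
      ∑ H (λ y′ → [ y′ ∈ π y ] * f y′) ≡ f y + p * v
    ∑-block f y v others = +-cancelʳ-≡ v _ _ (begin
      ∑ H (λ z → [ z ∈ π y ] * f z) + v
        ≡⟨ cong (∑ H (λ z → [ z ∈ π y ] * f z) +_) (point v) ⟨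
      ∑ H (λ z → [ z ∈ π y ] * f z) + ∑ H (λ z → v * bit (eqV H z y))
        ≡⟨ ∑-+ H (λ z → [ z ∈ π y ] * f z) (λ z → v * bit (eqV H z y)) ⟨
      ∑ H (λ z → [ z ∈ π y ] * f z + v * bit (eqV H z y))
        ≡⟨ ∑-cong H swap ⟩
      ∑ H (λ z → v * [ z ∈ π y ] + f y * bit (eqV H z y))
        ≡⟨ ∑-+ H (λ z → v * [ z ∈ π y ]) (λ z → f y * bit (eqV H z y)) ⟩
      ∑ H (λ z → v * [ z ∈ π y ]) + ∑ H (λ z → f y * bit (eqV H z y))
        ≡⟨ cong₂ _+_ (trans (∑-* H v [_∈ π y ]) (cong (v *_) (block-size (π y)))) (point (f y)) ⟩
      v * suc p + f y
        ≡⟨ cong (_+ f y) (*-comm v (suc p)) ⟩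
      v + p * v + f y
        ≡⟨ +-comm (v + p * v) (f y) ⟩
      f y + (v + p * v)
        ≡⟨ cong (f y +_) (+-comm v (p * v)) ⟩
      f y + (p * v + v)
        ≡⟨ +-assoc (f y) (p * v) v ⟨
      f y + p * v + v ∎)
      where
      open ≡-Reasoning
      off : ∀ {z} → z ≢ y → ∀ c → c * bit (eqV H z y) ≡ 0
      off z≢y c = trans (cong (c *_) (bit-false (z≢y ∘ eqV⇒≡ H))) (*-zeroʳ c)
      point : ∀ c → ∑ H (λ z → c * bit (eqV H z y)) ≡ c
      point c = trans
        (∑-single H _ y (λ z z≢y → off z≢y c))
        (trans (cong (c *_) (bit-true (≡⇒eqV H refl))) (*-identityʳ c))
      swap : ∀ z → [ z ∈ π y ] * f z + v * bit (eqV H z y) ≡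
                   v * [ z ∈ π y ] + f y * bit (eqV H z y)
      swap z with _≟V_ H z y
      ... | yes refl = trans (cong₂ _+_ (trans (cong (_* f z) 1≡) (*-identityˡ (f z))) refl)
        (trans (+-comm (f z) _) (cong₂ _+_
          (cong (v *_) (trans (bit-true (≡⇒eqV H refl)) (sym 1≡)))
          (trans (sym (*-identityʳ (f z))) (cong (f z *_) (sym (bit-true (≡⇒eqV H refl)))))))
        where
        1≡ : [ z ∈ π y ] ≡ 1
        1≡ = bit-true (≡⇒eqV G refl)
      ... | no z≢y with _≟V_ G (π z) (π y)
      ... | yes πz = cong₂ _+_
        (trans (cong ([ z ∈ π y ] *_) (others z πz z≢y)) (*-comm [ z ∈ π y ] v))
        (trans (off z≢y v) (sym (off z≢y (f y))))
      ... | no πz≢ = cong₂ _+_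
        (trans (cong (_* f z) 0≡) (sym (trans (cong (v *_) 0≡) (*-zeroʳ v))))
        (trans (off z≢y v) (sym (off z≢y (f y))))
        where
        0≡ : [ z ∈ π y ] ≡ 0
        0≡ = bit-false (πz≢ ∘ eqV⇒≡ G)

    far : ℕ → ℕ
    far i = i ⊔ (D ∸ i)

    -- The weight is left free because both sides of the double count are sums over fibres: one with
    -- the indicator of the sphere, the other with the intersection numbers of `H`.
    ∑-block-dist : ∀ (φ : ℕ → ℕ) x b →
      ∑ H (λ y → [ y ∈ b ] * φ (dist x y)) ≡
      φ (Base.dist (π x) b) + p * φ (far (Base.dist (π x) b))
    ∑-block-dist φ x b with nearest x b
    ... | y , refl , xy = trans
      (∑-block (φ ∘ dist x) y (φ (far (dist x y))) λ y′ πy′ y′≢y →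
        cong φ (dist-in-block x y y′ xy πy′ y′≢y))
      (cong (λ i → φ i + p * φ (far i)) xy)

    -- A weight replaces the radius because a fibre can meet the sphere of radius k through d = k or
    -- through `far d` = k, and linearity in the weight separates the two.
    baseNeighboursAt : (ℕ → ℕ) → V G → V G → ℕ
    baseNeighboursAt φ a b = ∑ G (λ c → bit (adj G b c) * φ (Base.dist a c))

    -- Both sides count the edges between the fibre of b and the sphere of radius k about x.
    double-count : ∀ k x b →
      ∑ G (λ c → bit (adj G b c) * ∑ H (λ z → [ z ∈ c ] * δ (dist x z) k)) ≡
      ∑ H (λ y → [ y ∈ b ] * neighboursAt k x y)
    double-count k x b = begin
      ∑ G (λ c → bit (adj G b c) * ∑ H (λ z → [ z ∈ c ] * δ (dist x z) k))
        ≡⟨ ∑-cong G (λ c → sym (∑-* H (bit (adj G b c)) (λ z → [ z ∈ c ] * δ (dist x z) k))) ⟩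
      ∑ G (λ c → ∑ H (λ z → bit (adj G b c) * ([ z ∈ c ] * δ (dist x z) k)))
        ≡⟨ ∑-swap G H (λ c z → bit (adj G b c) * ([ z ∈ c ] * δ (dist x z) k)) ⟩
      ∑ H (λ z → ∑ G (λ c → bit (adj G b c) * ([ z ∈ c ] * δ (dist x z) k)))
        ≡⟨ ∑-cong H collapse ⟩
      ∑ H (λ z → δ (dist x z) k * bit (adj G (π z) b))
        ≡⟨ ∑-cong H (λ z → cong (δ (dist x z) k *_) (sym (neighbour-lifts C z b))) ⟩
      ∑ H (λ z → δ (dist x z) k * ∑ H (λ y → [ y ∈ b ] * bit (adj H z y)))
        ≡⟨ ∑-cong H (λ z → sym (∑-* H (δ (dist x z) k) (λ y → [ y ∈ b ] * bit (adj H z y)))) ⟩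
      ∑ H (λ z → ∑ H (λ y → δ (dist x z) k * ([ y ∈ b ] * bit (adj H z y))))
        ≡⟨ ∑-swap H H (λ z y → δ (dist x z) k * ([ y ∈ b ] * bit (adj H z y))) ⟩
      ∑ H (λ y → ∑ H (λ z → δ (dist x z) k * ([ y ∈ b ] * bit (adj H z y))))
        ≡⟨ ∑-cong H regroup ⟩
      ∑ H (λ y → [ y ∈ b ] * neighboursAt k x y) ∎
      where
      open ≡-Reasoning
      collapse : ∀ z → ∑ G (λ c → bit (adj G b c) * ([ z ∈ c ] * δ (dist x z) k)) ≡
                       δ (dist x z) k * bit (adj G (π z) b)
      collapse z = trans
        (∑-single G _ (π z) λ c c≢πz → trans
          (cong (λ e → bit (adj G b c) * (e * δ (dist x z) k))
            (bit-false (c≢πz ∘ sym ∘ eqV⇒≡ G)))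
          (*-zeroʳ (bit (adj G b c))))
        (trans (cong (λ e → bit (adj G b (π z)) * (e * δ (dist x z) k)) (bit-true (≡⇒eqV G refl)))
          (trans (cong (bit (adj G b (π z)) *_) (*-identityˡ _))
            (trans (*-comm (bit (adj G b (π z))) _)
              (cong (λ e → δ (dist x z) k * bit e) (proj₁ base-isGraph b (π z))))))
      regroup : ∀ y → ∑ H (λ z → δ (dist x z) k * ([ y ∈ b ] * bit (adj H z y))) ≡
                      [ y ∈ b ] * neighboursAt k x y
      regroup y = trans (∑-cong H rearranged)
        (∑-* H [ y ∈ b ] (λ z → bit (adj H y z) * δ (dist x z) k))
        where
        rearranged : ∀ z → δ (dist x z) k * ([ y ∈ b ] * bit (adj H z y)) ≡
                           [ y ∈ b ] * (bit (adj H y z) * δ (dist x z) k)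
        rearranged z = trans (*-comm (δ (dist x z) k) _)
          (trans (*-assoc [ y ∈ b ] _ _)
            (cong (λ e → [ y ∈ b ] * (bit e * δ (dist x z) k)) (proj₁ isGraph z y)))

    private
      intersection : ∀ k → Σ (ℕ → ℕ) λ α → ∀ x y → neighboursAt k x y ≡ α (dist x y)
      intersection k = factors-through H dist (neighboursAt k) (neighboursAt-regular k)

    -- The equation of index k. Evaluating both sides of `double-count` by `∑-block-dist` leaves on
    -- the right a function of `Base.dist a b` alone, whichever lift of `a` was taken.
    sphere-edges : ∀ k {a b a′ b′} → Base.dist a b ≡ Base.dist a′ b′ →
      baseNeighboursAt (λ d → δ d k) a b + p * baseNeighboursAt (λ d → δ (far d) k) a b ≡
      baseNeighboursAt (λ d → δ d k) a′ b′ + p * baseNeighboursAt (λ d → δ (far d) k) a′ b′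
    sphere-edges k {a} {b} {a′} {b′} eq =
      trans (value a b) (trans (cong (λ i → α i + p * α (far i)) eq) (sym (value a′ b′)))
      where
      α : ℕ → ℕ
      α = proj₁ (intersection k)
      value : ∀ a b →
        baseNeighboursAt (λ d → δ d k) a b + p * baseNeighboursAt (λ d → δ (far d) k) a b ≡
        α (Base.dist a b) + p * α (far (Base.dist a b))
      value a b with surjective a
      ... | x , refl = begin
        ∑ G near + p * ∑ G away
          ≡⟨ cong (∑ G near +_) (sym (∑-* G p away)) ⟩
        ∑ G near + ∑ G (λ c → p * away c)
          ≡⟨ ∑-+ G near (λ c → p * away c) ⟨
        ∑ G (λ c → near c + p * away c)
          ≡⟨ ∑-cong G summand ⟩
        ∑ G (λ c → bit (adj G b c) * ∑ H (λ z → [ z ∈ c ] * δ (dist x z) k))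
          ≡⟨ double-count k x b ⟩
        ∑ H (λ y → [ y ∈ b ] * neighboursAt k x y)
          ≡⟨ ∑-cong H (λ y → cong ([ y ∈ b ] *_) (proj₂ (intersection k) x y)) ⟩
        ∑ H (λ y → [ y ∈ b ] * α (dist x y))
          ≡⟨ ∑-block-dist α x b ⟩
        α (Base.dist (π x) b) + p * α (far (Base.dist (π x) b)) ∎
        where
        open ≡-Reasoning
        near away : V G → ℕ
        near c = bit (adj G b c) * δ (Base.dist (π x) c) k
        away c = bit (adj G b c) * δ (far (Base.dist (π x) c)) k
        summand : ∀ c → near c + p * away c ≡
          bit (adj G b c) * ∑ H (λ z → [ z ∈ c ] * δ (dist x z) k)
        summand c = trans
          (cong (near c +_) (trans (sym (*-assoc p e f)) (trans (cong (_* f) (*-comm p e))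
            (*-assoc e p f))))
          (trans (sym (*-distribˡ-+ e _ _)) (cong (e *_) (sym (∑-block-dist (λ d → δ d k) x c))))
          where
          e f : ℕ
          e = bit (adj G b c)
          f = δ (far (Base.dist (π x) c)) k

    -- Solving the equations for the neighbours in the quotient

    baseNeighboursAt-cong : ∀ {φ ψ} → (∀ d → d ≤ D → φ d ≡ ψ d) → ∀ a b →
      baseNeighboursAt φ a b ≡ baseNeighboursAt ψ a b
    baseNeighboursAt-cong φ≗ψ a b =
      ∑-cong G (λ c → cong (bit (adj G b c) *_) (φ≗ψ (Base.dist a c) (Base.dist-≤ a c)))

    baseNeighboursAt-0 : ∀ a b → baseNeighboursAt (λ _ → 0) a b ≡ 0
    baseNeighboursAt-0 a b = ∑-zero G _ (λ c → *-zeroʳ (bit (adj G b c)))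

    baseNeighboursAt-+ : ∀ φ ψ a b → baseNeighboursAt (λ d → φ d + ψ d) a b ≡
      baseNeighboursAt φ a b + baseNeighboursAt ψ a b
    baseNeighboursAt-+ φ ψ a b = trans
      (∑-cong G (λ c → *-distribˡ-+ (bit (adj G b c)) (φ (Base.dist a c)) (ψ (Base.dist a c))))
      (∑-+ G (λ c → bit (adj G b c) * φ (Base.dist a c)) (λ c → bit (adj G b c) * ψ (Base.dist a c)))

    private
      -- `at k` is the unknown X_k; `beyond k` counts the neighbours of `b` whose fibres have their
      -- p other vertices on the sphere of radius k.
      at beyond : ℕ → V G → V G → ℕ
      at k     = baseNeighboursAt (λ d → δ d k)
      beyond k = baseNeighboursAt (λ d → δ (far d) k)

      far≡⇒ : ∀ {d k} → d ≤ D → far d ≡ k → d ≡ k ⊎ d ≡ D ∸ k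
      far≡⇒ {d} d≤D eq with ⊔-sel d (D ∸ d)
      ... | inj₁ far≡d = inj₁ (trans (sym far≡d) eq)
      ... | inj₂ far≡D∸d = inj₂ (trans (sym (m∸[m∸n]≡n d≤D))
        (cong (D ∸_) (trans (sym far≡D∸d) eq)))

      D≤far+far : ∀ d → D ≤ far d + far d
      D≤far+far d = ≤-trans (m≤n+m∸n D d) (+-mono-≤ (m≤m⊔n d (D ∸ d)) (m≤n⊔m d (D ∸ d)))

      far≤D : ∀ {d} → d ≤ D → far d ≤ D
      far≤D {d} d≤D = ⊔-lub d≤D (m∸n≤m D d)

      outside : ∀ k → (∀ d → d ≤ D → far d ≢ k) → ∀ a b → beyond k a b ≡ 0
      outside k far≢k a b = trans
        (baseNeighboursAt-cong (λ d d≤D → δ-no (far≢k d d≤D)) a b) (baseNeighboursAt-0 a b)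

      middle : ∀ k → k + k ≡ D → ∀ a b → beyond k a b ≡ at k a b
      middle k 2k≡D = baseNeighboursAt-cong λ d d≤D → bit-⇔
        (fromWitness {a? = d ≟ k} ∘ [ (λ eq → eq) , (λ eq → trans eq D∸k≡k) ]′ ∘
          far≡⇒ d≤D ∘ toWitness {a? = far d ≟ k})
        (fromWitness {a? = far d ≟ k} ∘ far-k ∘ toWitness {a? = d ≟ k})
        where
        D∸k≡k : D ∸ k ≡ k
        D∸k≡k = trans (cong (_∸ k) (sym 2k≡D)) (m+n∸n≡m k k)
        far-k : ∀ {d} → d ≡ k → far d ≡ k
        far-k refl = trans (cong (k ⊔_) D∸k≡k) (⊔-idem k)

      upper : ∀ k → k ≤ D → D < k + k → ∀ a b → beyond k a b ≡ at k a b + at (D ∸ k) a b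
      upper k k≤D D<2k a b = trans (baseNeighboursAt-cong split a b)
        (baseNeighboursAt-+ (λ d → δ d k) (λ d → δ d (D ∸ k)) a b)
        where
        D∸k<k : D ∸ k < k
        D∸k<k = +-cancelʳ-< k (D ∸ k) k (subst (_< k + k) (sym (m∸n+n≡m k≤D)) D<2k)
        split : ∀ d → d ≤ D → δ (far d) k ≡ δ d k + δ d (D ∸ k)
        split d d≤D with d ≟ k | d ≟ D ∸ k
        ... | yes refl | yes k≡D∸k = ⊥-elim (<-irrefl (sym k≡D∸k) D∸k<k)
        ... | yes refl | no _      = δ-yes (m≥n⇒m⊔n≡m (<⇒≤ D∸k<k))
        ... | no _     | yes refl  = δ-yes (trans (cong (D ∸ k ⊔_) (m∸[m∸n]≡n k≤D))
          (m≤n⇒m⊔n≡n (<⇒≤ D∸k<k)))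
        ... | no d≢k   | no d≢D∸k  = δ-no ([ d≢k , d≢D∸k ]′ ∘ far≡⇒ d≤D)

      at-regular-alone : ∀ k {a b a′ b′} → (∀ d → d ≤ D → far d ≢ k) →
        Base.dist a b ≡ Base.dist a′ b′ → at k a b ≡ at k a′ b′
      at-regular-alone k {a} {b} {a′} {b′} far≢k eq =
        trans (sym (simplify a b)) (trans (sphere-edges k eq) (simplify a′ b′))
        where
        simplify : ∀ a b → at k a b + p * beyond k a b ≡ at k a b
        simplify a b = trans (cong (λ y → at k a b + p * y) (outside k far≢k a b))
          (trans (cong (at k a b +_) (*-zeroʳ p)) (+-identityʳ _))

      at-regular-low : ∀ k {a b a′ b′} → k + k < D →
        Base.dist a b ≡ Base.dist a′ b′ → at k a b ≡ at k a′ b′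
      at-regular-low k 2k<D = at-regular-alone k λ d _ eq →
        <⇒≱ 2k<D (subst (λ f → D ≤ f + f) eq (D≤far+far d))

      at-regular-middle : ∀ k {a b a′ b′} → k + k ≡ D →
        Base.dist a b ≡ Base.dist a′ b′ → at k a b ≡ at k a′ b′
      -- Here the two unknowns coincide, and X_k + p X_k computes from `suc p * X_k`.
      at-regular-middle k {a} {b} {a′} {b′} 2k≡D eq = *-cancelˡ-≡ _ _ (suc p)
        (trans (cong (λ y → at k a b + p * y) (sym (middle k 2k≡D a b)))
          (trans (sphere-edges k eq) (cong (λ y → at k a′ b′ + p * y) (middle k 2k≡D a′ b′))))

      -- The equation reads (1 + p) X_k + p X_{D-k} = const, and X_{D-k} is already known because D
      -- - k lies strictly below D / 2.
      at-regular-upper : ∀ k {a b a′ b′} → k ≤ D → D < k + k →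
        Base.dist a b ≡ Base.dist a′ b′ → at k a b ≡ at k a′ b′
      at-regular-upper k {a} {b} {a′} {b′} k≤D D<2k eq = *-cancelˡ-≡ _ _ (suc p)
        (+-cancelʳ-≡ (p * at (D ∸ k) a b) _ _ (begin
          at k a b + p * at k a b + p * at (D ∸ k) a b       ≡⟨ expand a b ⟨
          at k a b + p * beyond k a b                        ≡⟨ sphere-edges k eq ⟩
          at k a′ b′ + p * beyond k a′ b′                    ≡⟨ expand a′ b′ ⟩
          at k a′ b′ + p * at k a′ b′ + p * at (D ∸ k) a′ b′ ≡⟨ cong (λ y → at k a′ b′ + p * at k a′ b′ + p * y)
                                                                  (at-regular-low (D ∸ k) reflected-low eq) ⟨
          at k a′ b′ + p * at k a′ b′ + p * at (D ∸ k) a b   ∎))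
        where
        open ≡-Reasoning
        expand : ∀ a b → at k a b + p * beyond k a b ≡ at k a b + p * at k a b + p * at (D ∸ k) a b
        expand a b = trans (cong (λ y → at k a b + p * y) (upper k k≤D D<2k a b))
          (trans (cong (at k a b +_) (*-distribˡ-+ p (at k a b) (at (D ∸ k) a b)))
            (sym (+-assoc (at k a b) _ _)))
        reflected-low : (D ∸ k) + (D ∸ k) < D
        reflected-low = subst ((D ∸ k) + (D ∸ k) <_) (m∸n+n≡m k≤D) (+-monoʳ-< (D ∸ k)
          (+-cancelʳ-< k (D ∸ k) k (subst (_< k + k) (sym (m∸n+n≡m k≤D)) D<2k)))

    at-regular : ∀ k a b a′ b′ → Base.dist a b ≡ Base.dist a′ b′ → at k a b ≡ at k a′ b′
    at-regular k a b a′ b′ eq with <-cmp (k + k) D | D <? k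
    ... | tri< 2k<D _ _ | _       = at-regular-low k 2k<D eq
    ... | tri≈ _ 2k≡D _ | _       = at-regular-middle k 2k≡D eq
    ... | tri> _ _ D<2k | no D≮k  = at-regular-upper k (≮⇒≥ D≮k) D<2k eq
    ... | tri> _ _ _    | yes D<k = at-regular-alone k
      (λ d d≤D far≡k → <⇒≱ D<k (subst (_≤ D) far≡k (far≤D d≤D))) eq

    quotient-distanceRegular : DistanceRegular G
    quotient-distanceRegular = (λ a b → D , base-bounded a b) , b , c , b-correct , c-correct
      where
      α : ℕ → ℕ → ℕ
      α k = proj₁ (factors-through G Base.dist (at k) (at-regular k))
      b c : ℕ → ℕ
      b i = α (suc i) i
      -- The conventional c_0; the condition on `c` concerns positive arguments.
      c zero    = 0
      c (suc i) = α i (suc i)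
      count≡α : ∀ k i u v → T (distIs G u v i) →
        count G (λ z → distIs G u z k ∧ adj G v z) ≡ α k i
      count≡α k i u v uv = trans (Base.count≡neighboursAt k u v)
        (trans (proj₂ (factors-through G Base.dist (at k) (at-regular k)) u v)
          (cong (α k) (Base.distIs⇒dist i uv)))
      b-correct : ∀ i u v → T (distIs G u v i) →
        count G (λ z → distIs G u z (suc i) ∧ adj G v z) ≡ b i
      b-correct i = count≡α (suc i) i
      c-correct : ∀ i u v → T (distIs G u v (suc i)) →
        count G (λ z → distIs G u z i ∧ adj G v z) ≡ c (suc i)
      c-correct i = count≡α i (suc i)

-- Sizes of fibres contained in one slice

-- `count` runs over all pairs, whereas a fibre sits in a single slice with fixed first coordinate.
-- The indicator of `P` is written as a sum of point masses at the `f i` with `Q i`, and the two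
-- summations are exchanged.
count-slice : ∀ (G : FinGraph) {r} (P : V G → Bool) (f : Fin r → V G) (Q : Fin r → Bool) →
  (∀ {i j} → f i ≡ f j → i ≡ j) →
  (∀ x → T (P x) → ∃ λ i → x ≡ f i × T (Q i)) → (∀ i → T (Q i) → T (P (f i))) →
  count G P ≡ countFin G Q
count-slice G P f Q f-injective P⇒Q Q⇒P = begin
  count G P
    ≡⟨ count≡∑ G P ⟩
  ∑ G (λ x → bit (P x))
    ≡⟨ ∑-cong G slice ⟩
  ∑ G (λ x → sum (λ i → bit (Q i) * bit (eqV G x (f i))))
    ≡⟨ ∑-comm (λ k i → bit (Q i) * bit (eqV G (to G k) (f i))) ⟩
  sum (λ i → ∑ G (λ x → bit (Q i) * bit (eqV G x (f i))))
    ≡⟨ sum-cong-≗ point ⟩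
  sum (λ i → bit (Q i))
    ≡⟨ countFin≡sum G Q ⟨
  countFin G Q ∎
  where
  open ≡-Reasoning
  point : ∀ i → ∑ G (λ x → bit (Q i) * bit (eqV G x (f i))) ≡ bit (Q i)
  point i = trans
    (∑-single G _ (f i) λ x x≢fi →
      trans (cong (bit (Q i) *_) (bit-false (x≢fi ∘ eqV⇒≡ G))) (*-zeroʳ (bit (Q i))))
    (trans (cong (bit (Q i) *_) (bit-true (≡⇒eqV G refl))) (*-identityʳ _))
  slice : ∀ x → bit (P x) ≡ sum (λ i → bit (Q i) * bit (eqV G x (f i)))
  slice x with T? (P x)
  ... | no ¬Px = trans (bit-false ¬Px) (sym (sum-zero _ λ i → trans
      (sym (bit-∧ (Q i) (eqV G x (f i))))
      (bit-false λ t → let (Qi , e) = T-∧⁻ {Q i} t in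
        ¬Px (subst (T ∘ P) (sym (eqV⇒≡ G e)) (Q⇒P i Qi)))))
  ... | yes Px with P⇒Q x Px
  ... | i , refl , Qi = trans (bit-true Px) (sym (trans
    (sum-single _ i λ j j≢i → trans
      (cong (bit (Q j) *_) (bit-false (j≢i ∘ f-injective ∘ sym ∘ eqV⇒≡ G))) (*-zeroʳ (bit (Q j))))
    (cong₂ _*_ (bit-true Qi) (bit-true (≡⇒eqV G refl)))))

countFin-true : ∀ G k → countFin G {k} (λ _ → true) ≡ k
countFin-true G zero    = refl
countFin-true G (suc k) = cong suc (countFin-true G k)

-- The cover of Γ by blocks

-- `coverGraph` with functions instead of permutations: the action on blocks is known to be
-- bijective only along edges, the generators being indexed by arcs.
productGraph : (Γ : FinGraph) (m : ℕ) → (V Γ → V Γ → Fin m → Fin m) → FinGraph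
productGraph Γ m τ = record
  { V    = V Γ × Fin m
  ; size = size Γ * m
  ; enum = ↔-trans F.*↔× (enum Γ ×-↔ ↔-refl)
  ; adj  = λ { (v , b) (w , c) → adj Γ v w ∧ ⌊ c F.≟ τ v w b ⌋ }
  }

two-elements : ∀ {m} → m > 1 → ∃₂ λ (i j : Fin m) → i ≢ j
two-elements (s≤s (s≤s _)) = zero , suc zero , λ ()

module BlockQuotient (Γ : FinGraph) (isGraphΓ : IsGraph Γ) (t : V Γ → V Γ → Bool)
         (m n : ℕ) (m>1 : m > 1) (n>1 : n > 1) (σ : V Γ → V Γ → Permutation′ (m * n))
         (rep : IsFundRep Γ t σ) (blocks : ImprimitiveBlocks Γ m n σ)
         (isGraph : IsGraph (coverGraph Γ σ)) where

  private
    H : FinGraph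
    H = coverGraph Γ σ

    β : Fin (m * n) → Fin m
    β = proj₁ blocks

    inverse : ∀ {v w} → T (adj Γ v w) → ∀ i → σ w v ⟨$⟩ʳ (σ v w ⟨$⟩ʳ i) ≡ i
    inverse a = proj₁ (proj₂ rep) _ _ a

    adjΓ-sym : ∀ {v w} → T (adj Γ v w) → T (adj Γ w v)
    adjΓ-sym = subst T (proj₁ isGraphΓ _ _)

    -- The triangle relation with its last factor moved across by the edge relation: g_{u,v} g_{v,w}
    -- = g_{u,w}.
    compose : ∀ {u v w} → T (adj Γ u v) → T (adj Γ u w) → T (adj Γ v w) →
      ∀ i → σ v w ⟨$⟩ʳ (σ u v ⟨$⟩ʳ i) ≡ σ u w ⟨$⟩ʳ i
    compose {u} {v} {w} uv uw vw i = trans (sym (inverse (adjΓ-sym uw) _))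
      (cong (σ u w ⟨$⟩ʳ_) (proj₂ (proj₂ rep) u v w uv vw uw i))

    β-preserved : ∀ {v w} → T (adj Γ v w) → ∀ {i j} → β i ≡ β j →
      β (σ v w ⟨$⟩ʳ i) ≡ β (σ v w ⟨$⟩ʳ j)
    β-preserved {v} {w} a = proj₂ (proj₂ blocks) ((v , w , false) ∷ []) (a ∷ []) _ _

    member : ∀ b → ∃ λ i → β i ≡ b
    member b with sum-bit-witness (λ i → ⌊ β i F.≟ b ⌋)
      (subst (_> 0) (trans (sym (proj₁ (proj₂ blocks) b))
        (countFin≡sum Γ (λ i → ⌊ β i F.≟ b ⌋))) (<-trans z<s n>1))
    ... | i , βi = i , toWitness {a? = β i F.≟ b} βi

  -- The action of g_{v,w} on blocks, read off at a chosen element of the block; one exists because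
  -- n > 0.
  τ : V Γ → V Γ → Fin m → Fin m
  τ v w b = β (σ v w ⟨$⟩ʳ proj₁ (member b))

  Γ′ : FinGraph
  Γ′ = productGraph Γ m τ

  π : V Γ × Fin (m * n) → V Γ × Fin m
  π (v , i) = v , β i

  private
    -- Independence of the chosen element, by imprimitivity applied to a one-letter word. Through it
    -- the edge and triangle relations pass from points to blocks.
    τ-β : ∀ {v w} → T (adj Γ v w) → ∀ i → τ v w (β i) ≡ β (σ v w ⟨$⟩ʳ i)
    τ-β a i = β-preserved a (proj₂ (member (β i)))

    τ-inverse : ∀ {v w} → T (adj Γ v w) → ∀ b → τ w v (τ v w b) ≡ b
    τ-inverse a b = trans (τ-β (adjΓ-sym a) _)
      (trans (cong β (inverse a _)) (proj₂ (member b)))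

    τ-compose : ∀ {u v w} → T (adj Γ u v) → T (adj Γ u w) → T (adj Γ v w) →
      ∀ b → τ v w (τ u v b) ≡ τ u w b
    τ-compose uv uw vw b = trans (τ-β vw _) (cong β (compose uv uw vw _))

    adj′⁻ : ∀ {v b w c} → T (adj Γ′ (v , b) (w , c)) → T (adj Γ v w) × c ≡ τ v w b
    adj′⁻ {v} {b} {w} {c} e with T-∧⁻ {adj Γ v w} e
    ... | a , f = a , toWitness {a? = c F.≟ τ v w b} f

    adj′⁺ : ∀ {v b w c} → T (adj Γ v w) → c ≡ τ v w b → T (adj Γ′ (v , b) (w , c))
    adj′⁺ {v} {b} {w} {c} a f = T-∧⁺ a (fromWitness {a? = c F.≟ τ v w b} f)

    adjH⁻ : ∀ {v i w j} → T (adj H (v , i) (w , j)) → T (adj Γ v w) × j ≡ σ v w ⟨$⟩ʳ i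
    adjH⁻ {v} {i} {w} {j} e with T-∧⁻ {adj Γ v w} e
    ... | a , f = a , toWitness {a? = j F.≟ σ v w ⟨$⟩ʳ i} f

    adjH⁺ : ∀ {v i w j} → T (adj Γ v w) → j ≡ σ v w ⟨$⟩ʳ i → T (adj H (v , i) (w , j))
    adjH⁺ {v} {i} {w} {j} a f = T-∧⁺ a (fromWitness {a? = j F.≟ σ v w ⟨$⟩ʳ i} f)

    Γ′-sym : ∀ x y → T (adj Γ′ x y) → T (adj Γ′ y x)
    Γ′-sym (v , b) (w , c) e with adj′⁻ {v} {b} {w} {c} e
    ... | a , refl = adj′⁺ {w} {c} {v} {b} (adjΓ-sym a) (sym (τ-inverse a b))

    Γ′-isGraph : IsGraph Γ′
    Γ′-isGraph = (λ x y → T-⇔⇒≡ (Γ′-sym x y) (Γ′-sym y x))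
      , λ { (v , b) → ¬T⇒false λ e →
              false⇒¬T (proj₂ isGraphΓ v) (proj₁ (adj′⁻ {v} {b} {v} {b} e)) }

  quotient-covering : IsCovering Γ Γ′ proj₁
  quotient-covering = record
    { base-isGraph  = isGraphΓ
    ; isGraph       = Γ′-isGraph
    ; surjective    = λ v → (v , base-block) , refl
    ; hom           = λ { {v , b} {w , c} e → proj₁ (adj′⁻ {v} {b} {w} {c} e) }
    ; lift          = λ { (v , b) {w} a → (w , τ v w b) , adj′⁺ {v} {b} a refl , refl }
    ; lift-unique   = λ { {v , b} {w , c} {.w , d} e f refl → cong (w ,_)
        (trans (proj₂ (adj′⁻ {v} {b} {w} {c} e)) (sym (proj₂ (adj′⁻ {v} {b} {w} {d} f)))) }
    ; lift-triangle = λ { {u , b} {v , c} {w , d} → triangle {u} {b} {v} {c} {w} {d} }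
    }
    where
    base-block : Fin m
    base-block = proj₁ (two-elements m>1)
    triangle : ∀ {u b v c w d} → T (adj Γ′ (u , b) (v , c)) → T (adj Γ′ (u , b) (w , d)) →
      T (adj Γ v w) → T (adj Γ′ (v , c) (w , d))
    triangle {u} {b} {v} {c} {w} {d} e f vw with adj′⁻ {u} {b} {v} {c} e | adj′⁻ {u} {b} {w} {d} f
    ... | uv , refl | uw , refl = adj′⁺ {v} {c} {w} {d} vw (sym (τ-compose uv uw vw b))

  cover-covering : IsCovering Γ′ H π
  cover-covering = record
    { base-isGraph  = Γ′-isGraph
    ; isGraph       = isGraph
    ; surjective    = λ { (v , b) → (v , proj₁ (member b)) , cong (v ,_) (proj₂ (member b)) }
    ; hom           = λ { {v , i} {w , j} → hom {v} {i} {w} {j} }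
    ; lift          = λ { (v , i) {w , c} → lift {v} {i} {w} {c} }
    ; lift-unique   = λ { {v , i} {w , j} {w′ , k} → lift-unique {v} {i} {w} {j} {w′} {k} }
    ; lift-triangle = λ { {u , i} {v , j} {w , k} → triangle {u} {i} {v} {j} {w} {k} }
    }
    where
    hom : ∀ {v i w j} → T (adj H (v , i) (w , j)) → T (adj Γ′ (v , β i) (w , β j))
    hom {v} {i} {w} {j} e with adjH⁻ {v} {i} {w} {j} e
    ... | a , refl = adj′⁺ {v} {β i} {w} {β j} a (sym (τ-β a i))
    lift : ∀ {v i w c} → T (adj Γ′ (v , β i) (w , c)) →
      ∃ λ y → T (adj H (v , i) y) × π y ≡ (w , c)
    lift {v} {i} {w} {c} e with adj′⁻ {v} {β i} {w} {c} e
    ... | a , refl = (w , σ v w ⟨$⟩ʳ i) , adjH⁺ {v} {i} a refl , cong (w ,_) (sym (τ-β a i))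
    lift-unique : ∀ {v i w j w′ k} → T (adj H (v , i) (w , j)) → T (adj H (v , i) (w′ , k)) →
      π (w , j) ≡ π (w′ , k) → (w , j) ≡ (w′ , k)
    lift-unique {v} {i} {w} {j} {w′} {k} e f eq with cong proj₁ eq
    ... | refl = cong (w ,_)
      (trans (proj₂ (adjH⁻ {v} {i} {w} {j} e)) (sym (proj₂ (adjH⁻ {v} {i} {w} {k} f))))
    triangle : ∀ {u i v j w k} → T (adj H (u , i) (v , j)) → T (adj H (u , i) (w , k)) →
      T (adj Γ′ (v , β j) (w , β k)) → T (adj H (v , j) (w , k))
    triangle {u} {i} {v} {j} {w} {k} e f g
      with adjH⁻ {u} {i} {v} {j} e | adjH⁻ {u} {i} {w} {k} f | adj′⁻ {v} {β j} {w} {β k} g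
    ... | uv , refl | uw , refl | vw , _ = adjH⁺ {v} {j} {w} {k} vw (sym (compose uv uw vw i))

  quotient-fibre-size : ∀ v → count Γ′ (fibre Γ Γ′ proj₁ v) ≡ m
  quotient-fibre-size v = trans
    (count-slice Γ′ (fibre Γ Γ′ proj₁ v) (v ,_) (λ _ → true) (cong proj₂)
      (λ { (w , b) e → b , cong (_, b) (eqV⇒≡ Γ e) , _ })
      (λ _ _ → ≡⇒eqV Γ refl))
    (countFin-true Γ′ m)

  cover-fibre-size : ∀ x → count H (fibre Γ′ H π x) ≡ n
  cover-fibre-size (v , b) = trans
    (count-slice H (fibre Γ′ H π (v , b)) (v ,_) (λ i → ⌊ β i F.≟ b ⌋) (cong proj₂) in-block
      (λ i βi → ≡⇒eqV Γ′ (cong (v ,_) (toWitness {a? = β i F.≟ b} βi))))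
    (trans (trans (countFin≡sum H P) (sym (countFin≡sum Γ P))) (proj₁ (proj₂ blocks) b))
    where
    P : Fin (m * n) → Bool
    P i = ⌊ β i F.≟ b ⌋
    in-block : ∀ x → T (fibre Γ′ H π (v , b) x) → ∃ λ i → x ≡ (v , i) × T ⌊ β i F.≟ b ⌋
    in-block (w , i) e = i , cong (_, i) (cong proj₁ (eqV⇒≡ Γ′ {w , β i} {v , b} e))
      , fromWitness {a? = β i F.≟ b} (cong proj₂ (eqV⇒≡ Γ′ {w , β i} {v , b} e))

-- The block cover as an antipodal quotient of Γ_ρ

theorem3p1 : (Γ : FinGraph) → IsGraph Γ → NonComplete Γ → DistanceRegular Γ →
    (t : V Γ → V Γ → Bool) → IsSpanningTree Γ t →
    (m n : ℕ) → m > 1 → n > 1 →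
    (σ : V Γ → V Γ → Permutation′ (m * n)) →
    IsFundRep Γ t σ → Transitive Γ σ → ImprimitiveBlocks Γ m n σ →
    IsAntipodalCover Γ (coverGraph Γ σ) (m * n) proj₁ →
    DistanceRegular (coverGraph Γ σ) →
    Σ FinGraph λ Γ' → Σ (V Γ' → V Γ) λ θ' → Σ (V Γ × Fin (m * n) → V Γ') λ θ'' →
    IsAntipodalCover Γ Γ' m θ' × DistanceRegular Γ' ×
    IsRCover Γ' (coverGraph Γ σ) n θ'' ×
    (∀ x → θ' (θ'' x) ≡ proj₁ x)
theorem3p1 Γ isGraphΓ (v₀ , _) _ t _ m n m>1 n>1 σ rep _ blocks
  ((cover , _) , _ , D , ((x , y , xy) , bounded) , antipodal) regular =
  Γ′ , proj₁ , π
  , ( (covering⇒cover quotient-covering , quotient-fibre-size)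
    , (λ a b → D , base-bounded a b)
    , D
    , (diameter (two-elements m>1) , base-bounded)
    , λ a b → [ cong proj₁ ∘ eqV⇒≡ Γ′ , antipodal⇒fibre ]′ ∘ T-∨⁻ , antipodal-class a b)
  , quotient-distanceRegular regular xy
      -- Thus p is n - 1, the number of vertices of a fibre besides the nearest one.
      (λ b → trans (cover-fibre-size b) (sym (suc-pred n {{>-nonZero (<-trans z<s n>1)}})))
  , (covering⇒cover cover-covering , cover-fibre-size)
  , λ _ → refl
  where
  H : FinGraph
  H = coverGraph Γ σ

  open BlockQuotient Γ isGraphΓ t m n m>1 n>1 σ rep blocks (IsCover.isGraph cover)

  antipodal⁻ : ∀ {x y : V H} → proj₁ x ≡ proj₁ y → x ≢ y → T (distIs H x y D)
  antipodal⁻ {x} {y} θ≡ x≢y with T-∨⁻ {eqV H x y} (proj₂ (antipodal x y) θ≡)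
  ... | inj₁ x≡y = ⊥-elim (x≢y (eqV⇒≡ H {x} {y} x≡y))
  ... | inj₂ d   = d

  antipodal⁺ : ∀ {x y : V H} → T (distIs H x y D) → proj₁ x ≡ proj₁ y
  antipodal⁺ {x} {y} d = proj₁ (antipodal x y) (T-∨⁺ {eqV H x y} (inj₂ d))

  -- With θ the projection of Γ′ onto Γ, θ ∘ π is the covering map of Γ_ρ onto Γ, whose fibres are
  -- the antipodal classes.
  open AntipodalQuotient {Γ′} {H} {π} cover-covering D bounded {V Γ} proj₁
    (λ {x} {y} → antipodal⁻ {x} {y}) (λ {x} {y} → antipodal⁺ {x} {y})

  -- Here m > 1 enters: two blocks over one vertex are at distance exactly D, so the bound D
  -- inherited from Γ_ρ is attained in Γ′.
  diameter : (∃₂ λ (i j : Fin m) → i ≢ j) → ∃ λ a → ∃ λ b → T (distIs Γ′ a b D)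
  diameter (i , j , i≢j) = (v₀ , i) , (v₀ , j)
    , fibre⇒antipodal {v₀ , i} {v₀ , j} refl (i≢j ∘ cong proj₂)

  antipodal-class : ∀ a b → proj₁ a ≡ proj₁ b → T (eqV Γ′ a b ∨ distIs Γ′ a b D)
  antipodal-class a b θ≡ with _≟V_ Γ′ a b
  ... | yes a≡b = T-∨⁺ {eqV Γ′ a b} (inj₁ (≡⇒eqV Γ′ a≡b))
  ... | no a≢b  = T-∨⁺ {eqV Γ′ a b} (inj₂ (fibre⇒antipodal {a} {b} θ≡ a≢b))
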